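{- For $t\in\mathbb{Q}\setminus\{ -1\}$ let $\phi_t(x)=\dfrac{x-t}{x^3+1}$. Let $\beta\in\mathbb{Q}(t)$ with $\deg(\beta)\geq3$. Then \[\limsup_{B\to\infty}\frac{\sum_{t\in\mathbb{Q}\setminus\{ -1\},\,h(\beta(t))\leq B}\#\big(\mathcal{O}_{\phi_t}(\beta(t))\cap\mathbb{Z}\big)}{\#\{t\in\mathbb{Q}\setminus\{ -1\}: h(\beta(t))\leq B\}}=0.\]
   Context: $\mathcal{O}_{\phi}(b)=\{b,\phi(b),\phi^2(b),\dots\}$ is the forward orbit in $\mathbb{P}^1(\mathbb{Q})$, and $\mathcal{O}_\phi(b)\cap\mathbb{Z}$ is the set of orbit points that are integers. $h$ is the logarithmic Weil height on $\mathbb{P}^1(\mathbb{Q})$. (Here the parameter set $\mathbb{Q}\setminus\{ -1\}=\mathbb{P}^1(\mathbb{Q})\setminus\{ -1,\infty\}$ is exactly the set of $t$ for which $\phi_t$ is a degree-3 rational map whose second iterate is not a polynomial.) -}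

module Defs where

open import Data.Nat as ℕ using (ℕ; zero; suc; _⊔_)
open import Data.Integer as ℤ using (ℤ; +_)
open import Data.Rational as ℚ
  using (ℚ; 0ℚ; 1ℚ; _+_; _*_; _-_; -_; _÷_; ↥_; ↧ₙ_; ≢-nonZero; _<_)
open import Data.Rational.Properties using (_≟_)
open import Data.List using (List; []; _∷_; length)
open import Data.Nat.ListAction using (sum)
open import Data.List.Membership.Propositional using (_∈_)
open import Data.List.Relation.Unary.Unique.Propositional using (Unique)
open import Data.List.Relation.Binary.Pointwise using (Pointwise)
open import Data.Maybe using (Maybe; just; nothing)
open import Data.Product using (Σ; ∃; _×_)
open import Function.Bundles using (_⇔_)
open import Relation.Nullary using (¬_; yes; no)
open import Relation.Binary.PropositionalEquality using (_≡_; _≢_)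

-- Polynomials over ℚ as coefficient lists, lowest degree first.
Poly : Set
Poly = List ℚ

coeff : Poly → ℕ → ℚ
coeff []       _       = 0ℚ
coeff (a ∷ p)  zero    = a
coeff (a ∷ p)  (suc i) = coeff p i

eval : Poly → ℚ → ℚ
eval []      x = 0ℚ
eval (a ∷ p) x = a + x * eval p x

_+P_ : Poly → Poly → Poly
[]      +P q       = q
(a ∷ p) +P []      = a ∷ p
(a ∷ p) +P (b ∷ q) = (a + b) ∷ (p +P q)

scale : ℚ → Poly → Poly
scale c []      = []
scale c (a ∷ p) = (c * a) ∷ scale c p

_*P_ : Poly → Poly → Poly
[]      *P q = []
(a ∷ p) *P q = scale a q +P (0ℚ ∷ (p *P q))

_≈P_ : Poly → Poly → Set
p ≈P q = ∀ i → coeff p i ≡ coeff q i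

Coprime : Poly → Poly → Set
Coprime p q = Σ Poly λ a → Σ Poly λ b → ((a *P p) +P (b *P q)) ≈P (1ℚ ∷ [])

DegGe3 : Poly → Set
DegGe3 p = Σ ℕ λ i → (3 ℕ.≤ i) × (coeff p i ≢ 0ℚ)

record RatFun : Set where
  field
    num   : Poly
    den   : Poly
    den≢0 : Σ ℕ λ i → coeff den i ≢ 0ℚ
    cop   : Coprime num den

-- deg β = max(deg num, deg den) ≥ 3  (β in lowest terms)
DegRatFunGe3 : RatFun → Set
DegRatFunGe3 β = DegGe3 (RatFun.num β) Data.Sum.⊎ DegGe3 (RatFun.den β)
  where import Data.Sum

-- P¹(ℚ) = ℚ ∪ {∞}, with ∞ = nothing
P1 : Set
P1 = Maybe ℚ

evalRF : RatFun → ℚ → P1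
evalRF β t with eval (RatFun.den β) t ≟ 0ℚ
... | yes _  = nothing
... | no d≢0 = just ((eval (RatFun.num β) t ÷ eval (RatFun.den β) t) {{≢-nonZero d≢0}})

-- multiplicative height H; logarithmic height h = log H.  H(∞) = 1.
Ht : P1 → ℕ
Ht nothing  = 1
Ht (just x) = ℤ.∣ ↥ x ∣ ⊔ (↧ₙ x)

phi : ℚ → P1 → P1
phi t nothing  = just 0ℚ
phi t (just x) with (x * x * x + 1ℚ) ≟ 0ℚ
... | yes _  = nothing
... | no d≢0 = just (((x - t) ÷ (x * x * x + 1ℚ)) {{≢-nonZero d≢0}})

iter : ℕ → (P1 → P1) → P1 → P1
iter zero    f x = x
iter (suc n) f x = f (iter n f x)

IsInt : ℚ → Set
IsInt x = ↧ₙ x ≡ 1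

InIntOrbit : ℚ → P1 → ℚ → Set
InIntOrbit t b x = IsInt x × ∃ λ n → iter n (phi t) b ≡ just x

-- c = #(O_{φ_t}(b) ∩ ℤ)  (in particular this set is finite)
IntOrbitCount : ℚ → P1 → ℕ → Set
IntOrbitCount t b c =
  Σ (List ℚ) λ L → Unique L × (∀ x → (x ∈ L) ⇔ InIntOrbit t b x) × (length L ≡ c)

m1 : ℚ
m1 = - 1ℚ

EnumParams : RatFun → ℕ → List ℚ → Set
EnumParams β N Ts =
  Unique Ts × (∀ t → (t ∈ Ts) ⇔ ((t ≢ m1) × (Ht (evalRF β t) ℕ.≤ N)))

ℕtoℚ : ℕ → ℚ
ℕtoℚ n = (+ n) ℚ./ 1

-- The averaged count tends to 0 (limsup of a nonnegative quantity = 0):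
-- for every ε > 0 there is N₀ such that for all N ≥ N₀,
--   Σ_{t ∈ ℚ∖{-1}, H(β(t)) ≤ N} #(O_{φ_t}(β(t)) ∩ ℤ) < ε · #{t ∈ ℚ∖{-1} : H(β(t)) ≤ N}.
AvgIntOrbitTendsToZero : RatFun → Set
AvgIntOrbitTendsToZero β =
  ∀ (ε : ℚ) → 0ℚ < ε → Σ ℕ λ N₀ → ∀ N → N₀ ℕ.≤ N →
    Σ (List ℚ) λ Ts → EnumParams β N Ts ×
      Σ (List ℕ) λ cs →
        Pointwise (λ t c → IntOrbitCount t (evalRF β t) c) Ts cs ×
        (ℕtoℚ (sum cs) < ε * ℕtoℚ (length Ts))

{-# OPTIONS --safe #-}
module Submission where

-- Write t = a/b, x = u/v and φ_t(x) = u′/v′ in lowest terms, so that e·u′ = v²(ub − av) and e·v′ = b(u³ + v³)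
-- for some integer e. Eliminating u gives e ∣ b(a³ + b³), which is nonzero for t ≠ −1. Two consequences: H(x)³ ≤
-- 128·H(t)⁴·H(φ_t(x)), and H(x)² ≤ 4·H(t)⁴ whenever φ_t(x) is an integer. Hence once H(x)² ≥ 128·H(t)⁴, heights
-- never drop along the orbit and no later orbit point is an integer. Since deg β = d ≥ 3, H(β(t)) ≫ H(t)³, so
-- for all but finitely many t the only possible integer in the orbit is β(t) itself. For the remaining t a
-- pigeonhole argument bounds the time after which no new integer can appear.
--
-- Finally H(β(t)) ≍ H(t)^d, so if H(β(t)) ≤ N and S ≍ N^(1/d), then t has height O(S). Integrality of β(t)
-- forces the denominator form G(a, b) of β to be bounded, which leaves O(S) parameters. On the other hand the
-- fractions (2i+1)/2ʲ already give at least J·S parameters, for any fixed J and all large S.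

open import Data.Empty using (⊥; ⊥-elim)
open import Data.Fin using (Fin; toℕ)
import Data.Fin.Properties as Finₚ
open import Data.Integer as ℤ using (ℤ; +_; -[1+_]; ∣_∣; 0ℤ; 1ℤ)
open import Data.Integer.Divisibility.Signed using (_∣_; divides; 0∣⇒≡0; ∣n⇒∣m*n; ∣m⇒∣m*n; ∣m∣n⇒∣m+n)
import Data.Integer.Properties as ℤₚ
import Data.Integer.Tactic.RingSolver as ℤS
open import Data.List
  using (List; []; _∷_; _++_; length; map; filter; deduplicate; upTo; concatMap; catMaybes; cartesianProductWith; lookup)
open import Data.List.Membership.Propositional using (_∈_; _∉_; lose)
open import Data.List.Membership.Propositional.Properties
open import Data.List.Properties
  using (length-map; length-++; length-++-sucʳ; length-upTo; length-filter; length-deduplicate; length-mapMaybe;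
         filter-accept; Any-catMaybes⁺)
open import Data.List.Relation.Binary.Pointwise using (Pointwise; []; _∷_)
open import Data.List.Relation.Unary.All as All using (All; []; _∷_)
open import Data.List.Relation.Unary.AllPairs using ([]; _∷_)
open import Data.List.Relation.Unary.Any as Any using (here; there)
open import Data.List.Relation.Unary.Any.Properties using (lookup-index)
open import Data.List.Relation.Unary.Unique.Propositional using (Unique)
import Data.List.Relation.Unary.Unique.Propositional.Properties as Uniqueₚ
open import Data.Maybe using (just; nothing)
open import Data.Maybe.Properties using (just-injective)
import Data.Maybe.Relation.Unary.Any as MAny
open import Data.Nat as ℕ using (ℕ; zero; suc; z≤n; s≤s)
open import Data.Nat.Coprimality as Coprimality using () renaming (Coprime to Coprimeℕ)
import Data.Nat.Divisibility as ∣ℕ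
open import Data.Nat.GCD using (module Bézout)
open import Data.Nat.Induction using (<-rec)
open import Data.Nat.ListAction using (sum)
import Data.Nat.Properties as ℕₚ
import Data.Nat.Tactic.RingSolver as ℕS
open import Data.Product using (∃; ∃₂; _×_; _,_; proj₁; proj₂)
open import Data.Rational as ℚ using (ℚ; mkℚ; 0ℚ; 1ℚ; _÷_; ↥_; ↧_; ↧ₙ_)
import Data.Rational.Properties as ℚₚ
open import Data.Rational.Unnormalised using (*≡*; *<*)
import Data.Rational.Unnormalised.Properties as ℚᵘₚ
open import Data.Sum as Sum using (_⊎_; inj₁; inj₂; [_,_]′)
open import Function using (_∘_; mk⇔; Equivalence)
open import Relation.Binary.PropositionalEquality hiding (J)
open import Relation.Nullary using (Dec; yes; no; ¬_)
open import Relation.Nullary.Decidable using (¬?; _×-dec_; _⊎-dec_; dec⇒maybe; decidable-stable)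
import Tactic.RingSolver as RS
open import Tactic.RingSolver.Core.AlmostCommutativeRing as ACR using (AlmostCommutativeRing)
open import Defs

-- The degree hypothesis enters where β(t) is compared with the threshold: H(β(t))² is at least of
-- order H(t)^(2d), and 2d ≥ 6 beats the exponent 4 that cancellation in one step can cost. Two
-- cancellations are controlled by the same device (`descent`): the factor e of one step, and the
-- common factor of the two integral forms of β. In each case an elimination identity shows that the
-- factor divides a constant times a power of one quantity, and coprimality replaces that quantity
-- by a nonzero constant. For β the coprimality witness, homogenised, plays the part of a resultant.
-- Every single orbit count must be shown finite, also for t of small height, whose orbit may never
-- enter the growth regime. This is why recurrence inside a finite set of points is treated apart
-- from growth. The parameters of height at most S number about S², but it is enough to beat every
-- fixed multiple of S. Odd numerators over powers of 2 are in lowest terms automatically, which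
-- makes them easy to list without repetition.

module Ints where

  -- Integer estimates and the arithmetic of one step of φ_t

  open import Data.Integer
  open import Data.Integer.Properties
  open ℤS using (solve-∀)

  -- Each induction step trades one factor v for one factor c: w·c·vⁿ is α·vⁿ times w·s plus β times
  -- w·v^(n+1), so the hypotheses hold again with w·c in place of w and exponent n.
  descent : ∀ n e w s v c α β → c ≡ α * s + β * v →
            e ∣ w * s → e ∣ w * v ^ n → e ∣ w * c ^ n
  descent zero e w s v c α β _ _ ew = ew
  descent (suc n) e w s v c α β c≡ es ev =
    subst (e ∣_) (*-assoc w c (c ^ n))
      (descent n e (w * c) s v c α β c≡ (subst (e ∣_) (comm w s c) (∣m⇒∣m*n c es))
        (subst (e ∣_) (trans (id w s v α β (v ^ n)) (cong (λ z → w * z * v ^ n) (sym c≡)))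
          (∣m∣n⇒∣m+n (∣m⇒∣m*n (α * v ^ n) es) (∣n⇒∣m*n β ev))))
    where
    comm : ∀ w s c → w * s * c ≡ w * c * s
    comm = solve-∀
    id : ∀ w s v α β z → w * s * (α * z) + β * (w * (v * z)) ≡ w * (α * s + β * v) * z
    id = solve-∀

  abs-*-≤ : ∀ x y {X Y} → ∣ x ∣ ℕ.≤ X → ∣ y ∣ ℕ.≤ Y → ∣ x * y ∣ ℕ.≤ X ℕ.* Y
  abs-*-≤ x y p q = subst (ℕ._≤ _) (sym (abs-* x y)) (ℕₚ.*-mono-≤ p q)

  abs-+-≤ : ∀ x y {X Y} → ∣ x ∣ ℕ.≤ X → ∣ y ∣ ℕ.≤ Y → ∣ x + y ∣ ℕ.≤ X ℕ.+ Y
  abs-+-≤ x y p q = ℕₚ.≤-trans (∣i+j∣≤∣i∣+∣j∣ x y) (ℕₚ.+-mono-≤ p q)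

  abs-minus-≤ : ∀ x y {X Y} → ∣ x ∣ ℕ.≤ X → ∣ y ∣ ℕ.≤ Y → ∣ x - y ∣ ℕ.≤ X ℕ.+ Y
  abs-minus-≤ x y p q = ℕₚ.≤-trans (∣i-j∣≤∣i∣+∣j∣ x y) (ℕₚ.+-mono-≤ p q)

  1≤∣_∣ : ∀ {z} → z ≢ 0ℤ → 1 ℕ.≤ ∣ z ∣
  1≤∣_∣ {z} z≢0 = ℕₚ.n≢0⇒n>0 (λ p → z≢0 (∣i∣≡0⇒i≡0 p))

  ∣⇒abs-≤ : ∀ {e w} → w ≢ 0ℤ → e ∣ w → ∣ e ∣ ℕ.≤ ∣ w ∣
  ∣⇒abs-≤ {e} w≢0 (divides k refl) rewrite abs-* k e =
    ℕₚ.m≤n*m ∣ e ∣ ∣ k ∣ {{ℕ.≢-nonZero (λ p → w≢0 (cong (_* e) (∣i∣≡0⇒i≡0 {k} p)))}}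

  *-cancelˡ : ∀ {e x y} → e ≢ 0ℤ → e * x ≡ e * y → x ≡ y
  *-cancelˡ {e} {x} {y} e≢0 = *-cancelˡ-≡ e x y {{≢-nonZero e≢0}}

  *-≢0 : ∀ {x y} → x ≢ 0ℤ → y ≢ 0ℤ → x * y ≢ 0ℤ
  *-≢0 {x} x≢0 y≢0 xy≡0 = [ x≢0 , y≢0 ]′ (i*j≡0⇒i≡0∨j≡0 x xy≡0)

  square≤ : ∀ u v → u * u ≤ + 2 * (u * u - u * v + v * v)
  square≤ u v = 0≤i-j⇒j≤i (subst (0ℤ ≤_) (id u v) (+-mono-≤ (0≤² (u - v)) (0≤² v)))
    where
    0≤² : ∀ z → 0ℤ ≤ z * z
    0≤² (+ n) = subst (0ℤ ≤_) (pos-* n n) (+≤+ ℕ.z≤n)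
    0≤² -[1+ n ] = +≤+ ℕ.z≤n
    id : ∀ u v → (u - v) * (u - v) + v * v ≡ + 2 * (u * u - u * v + v * v) - u * u
    id = solve-∀

  abs-square≤ : ∀ u v → ∣ u ∣ ℕ.* ∣ u ∣ ℕ.≤ 2 ℕ.* ∣ u * u - u * v + v * v ∣
  abs-square≤ u v = drop‿+≤+ (≤-trans (≤-reflexive (sq u))
      (≤-trans (square≤ u v) (≤-trans (*-monoˡ-≤-nonNeg (+ 2) (i≤∣i∣ _))
      (≤-reflexive (sym (pos-* 2 ∣ u * u - u * v + v * v ∣))))))
    where
    sq : ∀ u → + (∣ u ∣ ℕ.* ∣ u ∣) ≡ u * u
    sq (+ n) = pos-* n n
    sq -[1+ n ] = refl
    i≤∣i∣ : ∀ i → i ≤ + ∣ i ∣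
    i≤∣i∣ (+ n) = ≤-refl
    i≤∣i∣ -[1+ n ] = -≤+

  -- The point (a : b) plays the role of t, (u : v) that of x, and (u′ : v′) that of φ_t(x).
  module Step (a b u v u′ v′ e x y : ℤ) (b≢0 : b ≢ 0ℤ) (t≢-1 : a * a * a + b * b * b ≢ 0ℤ)
              (bez : x * u + y * v ≡ 1ℤ)
              (numEq : e * u′ ≡ v * v * (u * b - a * v))
              (denEq : e * v′ ≡ b * (u * u * u + v * v * v)) where
    τ h h′ : ℕ
    τ = ∣ a ∣ ℕ.⊔ ∣ b ∣
    h = ∣ u ∣ ℕ.⊔ ∣ v ∣
    h′ = ∣ u′ ∣ ℕ.⊔ ∣ v′ ∣

    w s : ℤ
    w = b * (a * a * a + b * b * b)
    s = u * u * u + v * v * v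

    w≢0 : w ≢ 0ℤ
    w≢0 = *-≢0 b≢0 t≢-1

    β : ℤ
    β = + 3 * x * x * u * u * y + + 3 * x * u * y * y * v + y * y * y * v * v - x * x * x * v * v

    -- In the cube of the Bézout identity only x³u³ lacks a factor v, and u³ is s - v³. Hence s and
    -- v generate the unit ideal.
    unit : 1ℤ ≡ (x * x * x) * s + β * v
    unit = trans (sym (cong (λ z → z * z * z) bez)) (id x y u v)
      where
      id : ∀ x y u v → (x * u + y * v) * (x * u + y * v) * (x * u + y * v) ≡ (x * x * x) * (u * u * u + v * v * v) +
          (+ 3 * x * x * u * u * y + + 3 * x * u * y * y * v + y * y * y * v * v - x * x * x * v * v) * v
      id = solve-∀

    Q : ℤ
    Q = u * u * (b * b) + u * v * (a * b) + v * v * (a * a)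

    -- `Q` is the cofactor in b³u³ - a³v³ = (ub - av)·Q. This lets the numerator equation cancel the
    -- b³u³ of the denominator equation; what survives is (a³ + b³)v³, times the common factor b·v².
    resultant : w * v ^ 5 ≡ e * (b * (b * b * (v * v) * v′ - u′ * Q))
    resultant = begin
      w * v ^ 5 ≡⟨ id₁ a b u v ⟩
      b * (b * b * (v * v) * (b * s) - v * v * (u * b - a * v) * Q)
          ≡⟨ cong₂ (λ z z′ → b * (b * b * (v * v) * z - z′ * Q)) (sym denEq) (sym numEq) ⟩
      b * (b * b * (v * v) * (e * v′) - e * u′ * Q) ≡⟨ id₂ b (v * v) e u′ v′ Q ⟩
      e * (b * (b * b * (v * v) * v′ - u′ * Q)) ∎
      where
      open ≡-Reasoning
      id₁ : ∀ a b u v → b * (a * a * a + b * b * b) * (v * (v * (v * (v * (v * 1ℤ))))) ≡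
        b * (b * b * (v * v) * (b * (u * u * u + v * v * v)) - v * v * (u * b - a * v) *
            (u * u * (b * b) + u * v * (a * b) + v * v * (a * a)))
      id₁ = solve-∀
      id₂ : ∀ b z e u′ v′ q → b * (b * b * z * (e * v′) - e * u′ * q) ≡ e * (b * (b * b * z * v′ - u′ * q))
      id₂ = solve-∀

    -- The denominator equation gives e ∣ w·s and `resultant` gives e ∣ w·v⁵. As s and v are
    -- coprime, `descent` applies with c = 1.
    e∣w : e ∣ w
    e∣w = subst (e ∣_) (*-identityʳ w) (descent 5 e w s v 1ℤ (x * x * x) β unit
        (subst (e ∣_) (id b (a * a * a + b * b * b) s)
            (∣n⇒∣m*n (a * a * a + b * b * b) (divides v′ (trans (sym denEq) (*-comm e v′)))))
        (divides (b * (b * b * (v * v) * v′ - u′ * Q)) (trans resultant (*-comm e _))))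
      where
      id : ∀ b z s → z * (b * s) ≡ b * z * s
      id = solve-∀

    e≢0 : e ≢ 0ℤ
    e≢0 refl = w≢0 (0∣⇒≡0 e∣w)

    ∣a∣≤τ : ∣ a ∣ ℕ.≤ τ
    ∣a∣≤τ = ℕₚ.m≤m⊔n ∣ a ∣ ∣ b ∣
    ∣b∣≤τ : ∣ b ∣ ℕ.≤ τ
    ∣b∣≤τ = ℕₚ.m≤n⊔m ∣ a ∣ ∣ b ∣
    ∣u∣≤h : ∣ u ∣ ℕ.≤ h
    ∣u∣≤h = ℕₚ.m≤m⊔n ∣ u ∣ ∣ v ∣
    ∣v∣≤h : ∣ v ∣ ℕ.≤ h
    ∣v∣≤h = ℕₚ.m≤n⊔m ∣ u ∣ ∣ v ∣
    ∣u′∣≤h′ : ∣ u′ ∣ ℕ.≤ h′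
    ∣u′∣≤h′ = ℕₚ.m≤m⊔n ∣ u′ ∣ ∣ v′ ∣
    ∣v′∣≤h′ : ∣ v′ ∣ ℕ.≤ h′
    ∣v′∣≤h′ = ℕₚ.m≤n⊔m ∣ u′ ∣ ∣ v′ ∣

    τ≥1 : 1 ℕ.≤ τ
    τ≥1 = ℕₚ.≤-trans (1≤∣ b≢0 ∣) ∣b∣≤τ

    ∣e∣≤ : ∣ e ∣ ℕ.≤ 2 ℕ.* (τ ℕ.* τ ℕ.* τ ℕ.* τ)
    ∣e∣≤ = ℕₚ.≤-trans (∣⇒abs-≤ w≢0 e∣w)
      (subst (∣ w ∣ ℕ.≤_) (id τ)
        (abs-*-≤ b _ ∣b∣≤τ (abs-+-≤ (a * a * a) (b * b * b)
           (abs-*-≤ (a * a) a (abs-*-≤ a a ∣a∣≤τ ∣a∣≤τ) ∣a∣≤τ)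
           (abs-*-≤ (b * b) b (abs-*-≤ b b ∣b∣≤τ ∣b∣≤τ) ∣b∣≤τ))))
      where
      id : ∀ τ → τ ℕ.* (τ ℕ.* τ ℕ.* τ ℕ.+ τ ℕ.* τ ℕ.* τ) ≡ 2 ℕ.* (τ ℕ.* τ ℕ.* τ ℕ.* τ)
      id = ℕS.solve-∀

    -- Dividing `resultant` by e removes e entirely and leaves on the left the integer k = w/e,
    -- which is nonzero and so can only enlarge that side.
    ∣v∣⁵≤ : ∣ v ^ 5 ∣ ℕ.≤ 4 ℕ.* (τ ℕ.* τ ℕ.* τ) ℕ.* (h ℕ.* h) ℕ.* h′
    ∣v∣⁵≤ = ℕₚ.≤-trans ∣v⁵∣≤ (subst (∣ b * (b * b * (v * v) * v′ - u′ * Q) ∣ ℕ.≤_) (id τ h h′)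
        (abs-*-≤ b _ ∣b∣≤τ (abs-minus-≤ (b * b * (v * v) * v′) (u′ * Q)
          (abs-*-≤ (b * b * (v * v)) v′ (abs-*-≤ (b * b) (v * v) (abs-*-≤ b b ∣b∣≤τ ∣b∣≤τ) (abs-*-≤ v v ∣v∣≤h ∣v∣≤h)) ∣v′∣≤h′)
          (abs-*-≤ u′ Q ∣u′∣≤h′ (abs-+-≤ (u * u * (b * b) + u * v * (a * b)) (v * v * (a * a))
            (abs-+-≤ (u * u * (b * b)) (u * v * (a * b))
              (abs-*-≤ (u * u) (b * b) (abs-*-≤ u u ∣u∣≤h ∣u∣≤h) (abs-*-≤ b b ∣b∣≤τ ∣b∣≤τ))
              (abs-*-≤ (u * v) (a * b) (abs-*-≤ u v ∣u∣≤h ∣v∣≤h) (abs-*-≤ a b ∣a∣≤τ ∣b∣≤τ)))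
            (abs-*-≤ (v * v) (a * a) (abs-*-≤ v v ∣v∣≤h ∣v∣≤h) (abs-*-≤ a a ∣a∣≤τ ∣a∣≤τ)))))))
      where
      id : ∀ τ h h′ → τ ℕ.* (τ ℕ.* τ ℕ.* (h ℕ.* h) ℕ.* h′ ℕ.+ h′ ℕ.*
          (h ℕ.* h ℕ.* (τ ℕ.* τ) ℕ.+ h ℕ.* h ℕ.* (τ ℕ.* τ) ℕ.+ h ℕ.* h ℕ.* (τ ℕ.* τ)))
          ≡ 4 ℕ.* (τ ℕ.* τ ℕ.* τ) ℕ.* (h ℕ.* h) ℕ.* h′
      id = ℕS.solve-∀
      k : ℤ
      k = _∣_.quotient e∣w
      w≡ke : w ≡ k * e
      w≡ke = _∣_.equality e∣w
      k≢0 : k ≢ 0ℤ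
      k≢0 k≡0 = w≢0 (trans w≡ke (cong (_* e) k≡0))
      kv⁵ : k * v ^ 5 ≡ b * (b * b * (v * v) * v′ - u′ * Q)
      kv⁵ = *-cancelˡ e≢0 (trans (trans (sym (*-assoc e k (v ^ 5))) (cong (_* v ^ 5) (trans (*-comm e k) (sym w≡ke)))) resultant)
      ∣v⁵∣≤ : ∣ v ^ 5 ∣ ℕ.≤ ∣ b * (b * b * (v * v) * v′ - u′ * Q) ∣
      ∣v⁵∣≤ = subst (λ z → ∣ v ^ 5 ∣ ℕ.≤ z) (trans (sym (abs-* k (v ^ 5))) (cong ∣_∣ kv⁵))
        (ℕₚ.m≤n*m ∣ v ^ 5 ∣ ∣ k ∣ {{ℕ.>-nonZero 1≤∣ k≢0 ∣}})

    abs-cube : ∀ z → ∣ z * z * z ∣ ≡ ∣ z ∣ ℕ.* ∣ z ∣ ℕ.* ∣ z ∣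
    abs-cube z = trans (abs-* (z * z) z) (cong (ℕ._* ∣ z ∣) (abs-* z z))

    abs-pow5 : ∀ z → ∣ z ^ 5 ∣ ≡ ∣ z ∣ ℕ.* (∣ z ∣ ℕ.* (∣ z ∣ ℕ.* (∣ z ∣ ℕ.* ∣ z ∣)))
    abs-pow5 z = trans (cong (λ k → ∣ z * (z * (z * (z * k))) ∣) (*-identityʳ z))
      (trans (abs-* z _) (cong (∣ z ∣ ℕ.*_)
          (trans (abs-* z _) (cong (∣ z ∣ ℕ.*_) (trans (abs-* z _) (cong (∣ z ∣ ℕ.*_) (abs-* z z)))))))

    -- H⁵ ≤ 32V⁵ ≤ 32·4·τ³H²h′, and H² cancels: this is the origin of 128. The exponent of τ is then
    -- raised from 3 to 4 to match the other case.
    large-v : ∀ {V H} → H ℕ.≤ 2 ℕ.* V → V ℕ.* (V ℕ.* (V ℕ.* (V ℕ.* V))) ℕ.≤ 4 ℕ.* (τ ℕ.* τ ℕ.* τ) ℕ.* (H ℕ.* H) ℕ.* h′ →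
              H ℕ.* H ℕ.* H ℕ.≤ 128 ℕ.* (τ ℕ.* τ ℕ.* τ ℕ.* τ) ℕ.* h′
    large-v {V} {zero} _ _ = ℕ.z≤n
    large-v {V} {H@(suc _)} H≤2V V⁵≤ = ℕₚ.*-cancelˡ-≤ (H ℕ.* H) (begin
      H ℕ.* H ℕ.* (H ℕ.* H ℕ.* H) ≤⟨ ℕₚ.*-mono-≤ (ℕₚ.*-mono-≤ H≤2V H≤2V) (ℕₚ.*-mono-≤ (ℕₚ.*-mono-≤ H≤2V H≤2V) H≤2V) ⟩
      2 ℕ.* V ℕ.* (2 ℕ.* V) ℕ.* (2 ℕ.* V ℕ.* (2 ℕ.* V) ℕ.* (2 ℕ.* V)) ≡⟨ id₁ V ⟩
      32 ℕ.* (V ℕ.* (V ℕ.* (V ℕ.* (V ℕ.* V)))) ≤⟨ ℕₚ.*-monoʳ-≤ 32 V⁵≤ ⟩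
      32 ℕ.* (4 ℕ.* (τ ℕ.* τ ℕ.* τ) ℕ.* (H ℕ.* H) ℕ.* h′) ≡⟨ id₂ (τ ℕ.* τ ℕ.* τ) H h′ ⟩
      (H ℕ.* H) ℕ.* (128 ℕ.* (τ ℕ.* τ ℕ.* τ) ℕ.* h′)
          ≤⟨ ℕₚ.*-monoʳ-≤ (H ℕ.* H) (ℕₚ.*-monoˡ-≤ h′ (ℕₚ.*-monoʳ-≤ 128 (ℕₚ.m≤m*n (τ ℕ.* τ ℕ.* τ) τ {{ℕ.>-nonZero τ≥1}}))) ⟩
      (H ℕ.* H) ℕ.* (128 ℕ.* (τ ℕ.* τ ℕ.* τ ℕ.* τ) ℕ.* h′) ∎)
      where
      open ℕₚ.≤-Reasoning
      id₁ : ∀ V → 2 ℕ.* V ℕ.* (2 ℕ.* V) ℕ.* (2 ℕ.* V ℕ.* (2 ℕ.* V) ℕ.* (2 ℕ.* V)) ≡ 32 ℕ.* (V ℕ.* (V ℕ.* (V ℕ.* (V ℕ.* V))))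
      id₁ = ℕS.solve-∀
      id₂ : ∀ t H h′ → 32 ℕ.* (4 ℕ.* t ℕ.* (H ℕ.* H) ℕ.* h′) ≡ (H ℕ.* H) ℕ.* (128 ℕ.* t ℕ.* h′)
      id₂ = ℕS.solve-∀

    -- From 2V ≤ U the term BV³ is at most an eighth of BU³, so seven eighths of BU³ must come from
    -- E·h′. The resulting 16 is relaxed to 128 so that both cases share one constant.
    large-u : ∀ {B U V E T} → 1 ℕ.≤ B → 2 ℕ.* V ℕ.≤ U → E ℕ.≤ 2 ℕ.* T →
              B ℕ.* (U ℕ.* U ℕ.* U) ℕ.≤ E ℕ.* h′ ℕ.+ B ℕ.* (V ℕ.* V ℕ.* V) →
              U ℕ.* U ℕ.* U ℕ.≤ 128 ℕ.* T ℕ.* h′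
    large-u {B} {U} {V} {E} {T} B≥1 2V≤U E≤ BU³≤ = begin
      U ℕ.* U ℕ.* U ≤⟨ ℕₚ.m≤n*m (U ℕ.* U ℕ.* U) B {{ℕ.>-nonZero B≥1}} ⟩
      X ≤⟨ ℕₚ.m≤n*m X 7 ⟩
      7 ℕ.* X ≤⟨ ℕₚ.+-cancelˡ-≤ X (7 ℕ.* X) (8 ℕ.* (E ℕ.* h′)) 8X≤ ⟩
      8 ℕ.* (E ℕ.* h′) ≤⟨ ℕₚ.*-monoʳ-≤ 8 (ℕₚ.*-monoˡ-≤ h′ E≤) ⟩
      8 ℕ.* (2 ℕ.* T ℕ.* h′) ≡⟨ id₁ T h′ ⟩
      16 ℕ.* (T ℕ.* h′) ≤⟨ ℕₚ.*-monoˡ-≤ (T ℕ.* h′) (ℕₚ.≤ᵇ⇒≤ 16 128 _) ⟩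
      128 ℕ.* (T ℕ.* h′) ≡⟨ sym (ℕₚ.*-assoc 128 T h′) ⟩
      128 ℕ.* T ℕ.* h′ ∎
      where
      open ℕₚ.≤-Reasoning
      X : ℕ
      X = B ℕ.* (U ℕ.* U ℕ.* U)
      id₁ : ∀ T h′ → 8 ℕ.* (2 ℕ.* T ℕ.* h′) ≡ 16 ℕ.* (T ℕ.* h′)
      id₁ = ℕS.solve-∀
      id₂ : ∀ P B V → 8 ℕ.* (P ℕ.+ B ℕ.* (V ℕ.* V ℕ.* V)) ≡ B ℕ.* (2 ℕ.* V ℕ.* (2 ℕ.* V) ℕ.* (2 ℕ.* V)) ℕ.+ 8 ℕ.* P
      id₂ = ℕS.solve-∀
      8X≤ : X ℕ.+ 7 ℕ.* X ℕ.≤ X ℕ.+ 8 ℕ.* (E ℕ.* h′)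
      8X≤ = begin
        8 ℕ.* X ≤⟨ ℕₚ.*-monoʳ-≤ 8 BU³≤ ⟩
        8 ℕ.* (E ℕ.* h′ ℕ.+ B ℕ.* (V ℕ.* V ℕ.* V)) ≡⟨ id₂ (E ℕ.* h′) B V ⟩
        B ℕ.* (2 ℕ.* V ℕ.* (2 ℕ.* V) ℕ.* (2 ℕ.* V)) ℕ.+ 8 ℕ.* (E ℕ.* h′)
            ≤⟨ ℕₚ.+-monoˡ-≤ _ (ℕₚ.*-monoʳ-≤ B (ℕₚ.*-mono-≤ (ℕₚ.*-mono-≤ 2V≤U 2V≤U) 2V≤U)) ⟩
        X ℕ.+ 8 ℕ.* (E ℕ.* h′) ∎

    -- Eliminating u controls only v, which settles the case where v is comparable to h. When u is
    -- more than twice as large as v, bu³ dominates the denominator equation and that equation alone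
    -- is enough.
    growth : h ℕ.* h ℕ.* h ℕ.≤ 128 ℕ.* (τ ℕ.* τ ℕ.* τ ℕ.* τ) ℕ.* h′
    growth with ∣ u ∣ ℕ.≤? 2 ℕ.* ∣ v ∣
    ... | yes U≤2V = large-v {∣ v ∣} {h} (ℕₚ.⊔-lub U≤2V (ℕₚ.m≤n*m ∣ v ∣ 2))
            (subst (ℕ._≤ 4 ℕ.* (τ ℕ.* τ ℕ.* τ) ℕ.* (h ℕ.* h) ℕ.* h′) (abs-pow5 v) ∣v∣⁵≤)
    ... | no  U≰2V = subst (λ k → k ℕ.* k ℕ.* k ℕ.≤ 128 ℕ.* (τ ℕ.* τ ℕ.* τ ℕ.* τ) ℕ.* h′)
          (sym (ℕₚ.m≥n⇒m⊔n≡m (ℕₚ.≤-trans (ℕₚ.m≤n*m ∣ v ∣ 2) 2V≤U)))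
          (large-u {∣ b ∣} {∣ u ∣} {∣ v ∣} {∣ e ∣} {τ ℕ.* τ ℕ.* τ ℕ.* τ} (1≤∣ b≢0 ∣) 2V≤U ∣e∣≤ bu³≤)
      where
      2V≤U = ℕₚ.<⇒≤ (ℕₚ.≰⇒> U≰2V)
      id : ∀ b u v → b * (u * u * u) ≡ b * (u * u * u + v * v * v) - b * (v * v * v)
      id = solve-∀
      bu³≤ : ∣ b ∣ ℕ.* (∣ u ∣ ℕ.* ∣ u ∣ ℕ.* ∣ u ∣) ℕ.≤ ∣ e ∣ ℕ.* h′ ℕ.+ ∣ b ∣ ℕ.* (∣ v ∣ ℕ.* ∣ v ∣ ℕ.* ∣ v ∣)
      bu³≤ = subst₂ ℕ._≤_
        (trans (cong ∣_∣ (trans (cong (_- b * (v * v * v)) denEq) (sym (id b u v))))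
            (trans (abs-* b (u * u * u)) (cong (∣ b ∣ ℕ.*_) (abs-cube u)))) refl
        (abs-minus-≤ (e * v′) (b * (v * v * v)) (abs-*-≤ e v′ ℕₚ.≤-refl ∣v′∣≤h′)
            (abs-*-≤ b (v * v * v) ℕₚ.≤-refl (ℕₚ.≤-reflexive (abs-cube v))))

    -- With v′ = 1 the denominator equation reads e = b(u + v)(u² - uv + v²). The definite quadratic
    -- factor therefore divides e, so it is at most 2τ⁴, while it is at least h²/2.
    integral⇒small : v′ ≡ 1ℤ → h ℕ.* h ℕ.≤ 4 ℕ.* (τ ℕ.* τ ℕ.* τ ℕ.* τ)
    integral⇒small v′≡1 = begin
      h ℕ.* h ≤⟨ h²≤ ⟩
      2 ℕ.* ∣ q ∣ ≤⟨ ℕₚ.*-monoʳ-≤ 2 (∣⇒abs-≤ e≢0 (divides (b * (u + v)) (trans e≡ (id b u v)))) ⟩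
      2 ℕ.* ∣ e ∣ ≤⟨ ℕₚ.*-monoʳ-≤ 2 ∣e∣≤ ⟩
      2 ℕ.* (2 ℕ.* (τ ℕ.* τ ℕ.* τ ℕ.* τ)) ≡⟨ sym (ℕₚ.*-assoc 2 2 (τ ℕ.* τ ℕ.* τ ℕ.* τ)) ⟩
      4 ℕ.* (τ ℕ.* τ ℕ.* τ ℕ.* τ) ∎
      where
      open ℕₚ.≤-Reasoning
      q : ℤ
      q = u * u - u * v + v * v
      e≡ : e ≡ b * s
      e≡ = trans (sym (trans (cong (e *_) v′≡1) (*-identityʳ e))) denEq
      id : ∀ b u v → b * (u * u * u + v * v * v) ≡ b * (u + v) * (u * u - u * v + v * v)
      id = solve-∀
      q-sym : ∀ u v → v * v - v * u + u * u ≡ u * u - u * v + v * v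
      q-sym = solve-∀
      h²≤ : h ℕ.* h ℕ.≤ 2 ℕ.* ∣ q ∣
      h²≤ with ℕₚ.⊔-sel ∣ u ∣ ∣ v ∣
      ... | inj₁ p rewrite p = abs-square≤ u v
      ... | inj₂ p rewrite p = subst (λ z → ∣ v ∣ ℕ.* ∣ v ∣ ℕ.≤ 2 ℕ.* ∣ z ∣) (q-sym u v) (abs-square≤ v u)

-- Rational numbers and integer coordinates on the projective line

module Rationals where
  open import Data.Rational using (_+_; _*_; _-_; -_; 1/_; toℚᵘ)
  open import Data.Rational.Properties

  ℚ-ring : AlmostCommutativeRing _ _
  ℚ-ring = ACR.fromCommutativeRing +-*-commutativeRing (λ x → dec⇒maybe (0ℚ ≟ x))

  -- Built in lowest terms with denominator 1, so that the numerator is recovered by computation;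
  -- compare `ι-injective`.
  ι : ℤ → ℚ
  ι z = mkℚ z 0 (Coprimality.sym (Coprimality.1-coprimeTo ∣ z ∣))

  ι-injective : ∀ {m n} → ι m ≡ ι n → m ≡ n
  ι-injective = cong ↥_

  ι-+ : ∀ m n → ι (m ℤ.+ n) ≡ ι m + ι n
  ι-+ m n = toℚᵘ-injective (ℚᵘₚ.≃-trans (*≡* (id m n)) (ℚᵘₚ.≃-sym (toℚᵘ-homo-+ (ι m) (ι n))))
    where
    id : ∀ m n → (m ℤ.+ n) ℤ.* (1ℤ ℤ.* 1ℤ) ≡ (m ℤ.* 1ℤ ℤ.+ n ℤ.* 1ℤ) ℤ.* 1ℤ
    id = ℤS.solve-∀

  ι-* : ∀ m n → ι (m ℤ.* n) ≡ ι m * ι n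
  ι-* m n = toℚᵘ-injective (ℚᵘₚ.≃-trans (*≡* (id m n)) (ℚᵘₚ.≃-sym (toℚᵘ-homo-* (ι m) (ι n))))
    where
    id : ∀ m n → (m ℤ.* n) ℤ.* (1ℤ ℤ.* 1ℤ) ≡ (m ℤ.* n) ℤ.* 1ℤ
    id = ℤS.solve-∀

  ι-neg : ∀ m → ι (ℤ.- m) ≡ - ι m
  ι-neg (+ zero) = refl
  ι-neg (+ suc n) = refl
  ι-neg -[1+ n ] = refl

  ι-minus : ∀ m n → ι (m ℤ.- n) ≡ ι m - ι n
  ι-minus m n = trans (ι-+ m (ℤ.- n)) (cong (λ z → ι m + z) (ι-neg n))

  ↧*p≡↥ : ∀ p → ι (↧ p) * p ≡ ι (↥ p)
  ↧*p≡↥ p@record{} = toℚᵘ-injective (ℚᵘₚ.≃-trans (toℚᵘ-homo-* (ι (↧ p)) p) (*≡* (id (↥ p) (↧ p))))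
    where
    id : ∀ u v → (v ℤ.* u) ℤ.* 1ℤ ≡ u ℤ.* (1ℤ ℤ.* v)
    id = ℤS.solve-∀

  /1≡ι : ∀ z → z ℚ./ 1 ≡ ι z
  /1≡ι z = ↥p/↧p≡p (ι z)

  ÷-*-cancel : ∀ p q .{{_ : ℚ.NonZero q}} → (p ÷ q) * q ≡ p
  ÷-*-cancel p q = trans (*-assoc p (1/ q) q) (trans (cong (λ z → p * z) (*-inverseˡ q)) (*-identityʳ p))

  -- Reading ∞ as (1 : 0) puts poles and the point at infinity under the same coordinate equations
  -- as all other points.
  nu de : P1 → ℤ
  nu nothing  = 1ℤ
  nu (just x) = ↥ x
  de nothing  = 0ℤ
  de (just x) = ↧ x

  Ht≡ : ∀ X → Ht X ≡ ∣ nu X ∣ ℕ.⊔ ∣ de X ∣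
  Ht≡ nothing  = refl
  Ht≡ (just x) = refl

  bézoutℤ : ∀ m n → Coprimeℕ ∣ m ∣ n → ∃₂ λ x y → x ℤ.* m ℤ.+ y ℤ.* + n ≡ 1ℤ
  bézoutℤ m n c = signed m (unsigned (Coprimality.coprime-Bézout c))
    where
    move : ∀ p q → 1ℤ ℤ.+ p ≡ q → q ℤ.+ ℤ.- p ≡ 1ℤ
    move p q eq = trans (cong (ℤ._+ ℤ.- p) (sym eq)) (id p)
      where
      id : ∀ p → (1ℤ ℤ.+ p) ℤ.+ ℤ.- p ≡ 1ℤ
      id = ℤS.solve-∀
    unsigned : ∀ {k} → Bézout.Identity 1 k n → ∃₂ λ x y → x ℤ.* + k ℤ.+ y ℤ.* + n ≡ 1ℤ
    unsigned {k} (Bézout.+- x y eq) = + x , ℤ.- + y ,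
      trans (cong (λ z → + x ℤ.* + k ℤ.+ z) (sym (ℤₚ.neg-distribˡ-* (+ y) (+ n))))
        (move (+ y ℤ.* + n) (+ x ℤ.* + k)
          (trans (cong (λ z → 1ℤ ℤ.+ z) (sym (ℤₚ.pos-* y n))) (trans (cong +_ eq) (ℤₚ.pos-* x k))))
    unsigned {k} (Bézout.-+ x y eq) = ℤ.- + x , + y ,
      trans (ℤₚ.+-comm (ℤ.- + x ℤ.* + k) (+ y ℤ.* + n))
          (trans (cong (λ z → + y ℤ.* + n ℤ.+ z) (sym (ℤₚ.neg-distribˡ-* (+ x) (+ k))))
        (move (+ x ℤ.* + k) (+ y ℤ.* + n)
          (trans (cong (λ z → 1ℤ ℤ.+ z) (sym (ℤₚ.pos-* x k))) (trans (cong +_ eq) (ℤₚ.pos-* y n)))))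
    signed : ∀ m → (∃₂ λ x y → x ℤ.* + ∣ m ∣ ℤ.+ y ℤ.* + n ≡ 1ℤ) → ∃₂ λ x y → x ℤ.* m ℤ.+ y ℤ.* + n ≡ 1ℤ
    signed (+ k) r = r
    signed -[1+ k ] (x , y , eq) = ℤ.- x , y , trans (cong (ℤ._+ y ℤ.* + n) (id x (+ suc k))) eq
      where
      id : ∀ x k → ℤ.- x ℤ.* ℤ.- k ≡ x ℤ.* k
      id = ℤS.solve-∀

  bézoutℚ : ∀ p → ∃₂ λ x y → x ℤ.* ↥ p ℤ.+ y ℤ.* ↧ p ≡ 1ℤ
  bézoutℚ (mkℚ n d-1 c) = bézoutℤ n (suc d-1) (Coprimality.recompute c)

  bézoutP1 : ∀ X → ∃₂ λ x y → x ℤ.* nu X ℤ.+ y ℤ.* de X ≡ 1ℤ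
  bézoutP1 nothing  = 1ℤ , 0ℤ , refl
  bézoutP1 (just p) = bézoutℚ p

  -- If P = e·u and Q = e·v with xu + yv = 1, then necessarily e = xP + yQ; this is the witness.
  reduce : ∀ p P Q → ι Q * p ≡ ι P → ∃ λ e → (e ℤ.* ↥ p ≡ P) × (e ℤ.* ↧ p ≡ Q)
  reduce p P Q Qp≡P with x , y , bez ← bézoutℚ p = x ℤ.* P ℤ.+ y ℤ.* Q ,
      trans (id₁ x y u v P Q) (trans (cong (λ z → x ℤ.* u ℤ.* P ℤ.+ y ℤ.* z) cross) (trans (id₂ x y u v P) (unit P))) ,
      trans (id₃ x y u v P Q) (trans (cong (λ z → x ℤ.* z ℤ.+ y ℤ.* v ℤ.* Q) (sym cross)) (trans (id₄ x y u v Q) (unit Q)))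
    where
    u = ↥ p
    v = ↧ p
    assoc : ∀ q v p → q * (v * p) ≡ v * (q * p)
    assoc = RS.solve-∀ ℚ-ring
    cross : Q ℤ.* u ≡ P ℤ.* v
    cross = ι-injective (trans (ι-* Q u) (trans (cong (λ z → ι Q * z) (sym (↧*p≡↥ p))) (trans (assoc (ι Q) (ι v) p)
      (trans (cong (λ z → ι v * z) Qp≡P) (trans (sym (ι-* v P)) (cong ι (ℤₚ.*-comm v P)))))))
    unit : ∀ z → (x ℤ.* u ℤ.+ y ℤ.* v) ℤ.* z ≡ z
    unit z = trans (cong (ℤ._* z) bez) (ℤₚ.*-identityˡ z)
    id₁ : ∀ x y u v P Q → (x ℤ.* P ℤ.+ y ℤ.* Q) ℤ.* u ≡ x ℤ.* u ℤ.* P ℤ.+ y ℤ.* (Q ℤ.* u)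
    id₁ = ℤS.solve-∀
    id₂ : ∀ x y u v P → x ℤ.* u ℤ.* P ℤ.+ y ℤ.* (P ℤ.* v) ≡ (x ℤ.* u ℤ.+ y ℤ.* v) ℤ.* P
    id₂ = ℤS.solve-∀
    id₃ : ∀ x y u v P Q → (x ℤ.* P ℤ.+ y ℤ.* Q) ℤ.* v ≡ x ℤ.* (P ℤ.* v) ℤ.+ y ℤ.* v ℤ.* Q
    id₃ = ℤS.solve-∀
    id₄ : ∀ x y u v Q → x ℤ.* (Q ℤ.* u) ℤ.+ y ℤ.* v ℤ.* Q ≡ (x ℤ.* u ℤ.+ y ℤ.* v) ℤ.* Q
    id₄ = ℤS.solve-∀

  phiNum phiDen : ℚ → P1 → ℤ
  phiNum t X = de X ℤ.* de X ℤ.* (nu X ℤ.* ↧ t ℤ.- ↥ t ℤ.* de X)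
  phiDen t X = ↧ t ℤ.* (nu X ℤ.* nu X ℤ.* nu X ℤ.+ de X ℤ.* de X ℤ.* de X)

  ι-phiDen : ∀ t x → ι (phiDen t (just x)) ≡ ι (↧ t) * (ι (↧ x) * ι (↧ x) * ι (↧ x)) * (x * x * x + 1ℚ)
  ι-phiDen t x = begin
    ι (b ℤ.* (u ℤ.* u ℤ.* u ℤ.+ v ℤ.* v ℤ.* v)) ≡⟨ ι-* b _ ⟩
    ι b * ι (u ℤ.* u ℤ.* u ℤ.+ v ℤ.* v ℤ.* v)
        ≡⟨ cong (λ z → ι b * z) (trans (ι-+ (u ℤ.* u ℤ.* u) _) (cong₂ _+_ (ι-cube u) (ι-cube v))) ⟩
    ι b * (ι u * ι u * ι u + ι v * ι v * ι v) ≡⟨ cong (λ z → ι b * (z * z * z + ι v * ι v * ι v)) (sym (↧*p≡↥ x)) ⟩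
    ι b * (ι v * x * (ι v * x) * (ι v * x) + ι v * ι v * ι v) ≡⟨ id (ι b) (ι v) x ⟩
    ι b * (ι v * ι v * ι v) * (x * x * x + 1ℚ) ∎
    where
    open ≡-Reasoning
    u = ↥ x
    v = ↧ x
    b = ↧ t
    ι-cube : ∀ z → ι (z ℤ.* z ℤ.* z) ≡ ι z * ι z * ι z
    ι-cube z = trans (ι-* (z ℤ.* z) z) (cong (_* ι z) (ι-* z z))
    id : ∀ b v x → b * (v * x * (v * x) * (v * x) + v * v * v) ≡ b * (v * v * v) * (x * x * x + 1ℚ)
    id = RS.solve-∀ ℚ-ring

  ι-phiNum : ∀ t x → ι (phiNum t (just x)) ≡ ι (↧ t) * (ι (↧ x) * ι (↧ x) * ι (↧ x)) * (x - t)
  ι-phiNum t x = begin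
    ι (v ℤ.* v ℤ.* (u ℤ.* b ℤ.- a ℤ.* v)) ≡⟨ ι-* (v ℤ.* v) _ ⟩
    ι (v ℤ.* v) * ι (u ℤ.* b ℤ.- a ℤ.* v)
        ≡⟨ cong₂ _*_ (ι-* v v) (trans (ι-minus (u ℤ.* b) (a ℤ.* v)) (cong₂ _-_ (ι-* u b) (ι-* a v))) ⟩
    ι v * ι v * (ι u * ι b - ι a * ι v) ≡⟨ cong₂ (λ z w → ι v * ι v * (z * ι b - w * ι v)) (sym (↧*p≡↥ x)) (sym (↧*p≡↥ t)) ⟩
    ι v * ι v * (ι v * x * ι b - ι b * t * ι v) ≡⟨ id (ι b) (ι v) x t ⟩
    ι b * (ι v * ι v * ι v) * (x - t) ∎
    where
    open ≡-Reasoning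
    u = ↥ x
    v = ↧ x
    a = ↥ t
    b = ↧ t
    id : ∀ b v x t → v * v * (v * x * b - b * t * v) ≡ b * (v * v * v) * (x - t)
    id = RS.solve-∀ ℚ-ring

  phi-coordinates : ∀ t X → ∃ λ e → (e ℤ.* nu (phi t X) ≡ phiNum t X) × (e ℤ.* de (phi t X) ≡ phiDen t X)
  phi-coordinates t nothing = ↧ t , ℤₚ.*-zeroʳ (↧ t) , refl
  phi-coordinates t (just x) with (x * x * x + 1ℚ) ≟ 0ℚ
  -- At a pole the image is (1 : 0), so the multiplier is the numerator itself and the denominator
  -- has to vanish.
  ... | yes d≡0 = phiNum t (just x) , ℤₚ.*-identityʳ _ ,
          trans (ℤₚ.*-zeroʳ (phiNum t (just x)))
              (sym (ι-injective (trans (ι-phiDen t x) (trans (cong (λ z → k * z) d≡0) (*-zeroʳ k)))))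
        where k = ι (↧ t) * (ι (↧ x) * ι (↧ x) * ι (↧ x))
  ... | no d≢0 = reduce y (phiNum t (just x)) (phiDen t (just x))
          (trans (cong (_* y) (ι-phiDen t x))
              (trans (id k d y) (trans (cong (λ z → k * z) (÷-*-cancel (x - t) d {{ℚ.≢-nonZero d≢0}})) (sym (ι-phiNum t x)))))
        where
        k = ι (↧ t) * (ι (↧ x) * ι (↧ x) * ι (↧ x))
        d = x * x * x + 1ℚ
        y = ((x - t) ÷ d) {{ℚ.≢-nonZero d≢0}}
        id : ∀ k d y → k * d * y ≡ k * (y * d)
        id = RS.solve-∀ ℚ-ring

-- Growth of heights along an orbit

module Dynamics where
  open Ints
  open Rationals
  open import Data.Nat using (_*_; _≤_)

  τ : ℚ → ℕ
  τ t = Ht (just t)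

  1≤τ : ∀ t → 1 ≤ τ t
  1≤τ t@record{} = ℕₚ.≤-trans (ℕ.s≤s ℕ.z≤n) (ℕₚ.m≤n⊔m ∣ ↥ t ∣ (↧ₙ t))

  abstract
    threshold : ℕ → ℕ
    threshold n = 128 * (n * n * n * n)

    threshold≡ : ∀ n → threshold n ≡ 128 * (n * n * n * n)
    threshold≡ n = refl

  -- The growth estimate is H(X)³ ≤ `threshold`·H(φ(X)); once H(X)² reaches the threshold,
  -- cancelling H(X)² leaves H(X) ≤ H(φ(X)), so the condition reproduces itself.
  Big : ℚ → P1 → Set
  Big t X = threshold (τ t) ≤ Ht X * Ht X

  ↧≢0 : ∀ t → ↧ t ≢ 0ℤ
  ↧≢0 record{} ()

  sum-of-cubes≢0 : ∀ t → t ≢ m1 → ↥ t ℤ.* ↥ t ℤ.* ↥ t ℤ.+ ↧ t ℤ.* ↧ t ℤ.* ↧ t ≢ 0ℤ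
  sum-of-cubes≢0 t t≢-1 eq = [ a+b≢0 , q≢0 ]′ (ℤₚ.i*j≡0⇒i≡0∨j≡0 (a ℤ.+ b) (trans (sym (factor a b)) eq))
    where
    a b : ℤ
    a = ↥ t
    b = ↧ t
    factor : ∀ a b → a ℤ.* a ℤ.* a ℤ.+ b ℤ.* b ℤ.* b ≡ (a ℤ.+ b) ℤ.* (b ℤ.* b ℤ.- b ℤ.* a ℤ.+ a ℤ.* a)
    factor = ℤS.solve-∀
    rearrange : ∀ a b → a ≡ (a ℤ.+ b) ℤ.+ -[1+ 0 ] ℤ.* b
    rearrange = ℤS.solve-∀
    a+b≢0 : a ℤ.+ b ≢ 0ℤ
    a+b≢0 a+b≡0 = t≢-1 (ℚₚ.≃⇒≡ {t} {m1} (ℚ.*≡* (trans (ℤₚ.*-identityʳ a)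
      (trans (rearrange a b) (trans (cong (ℤ._+ -[1+ 0 ] ℤ.* b) a+b≡0) (ℤₚ.+-identityˡ _))))))
    q≢0 : b ℤ.* b ℤ.- b ℤ.* a ℤ.+ a ℤ.* a ≢ 0ℤ
    -- b² is at most twice the quadratic factor, so the vanishing of that factor would force b = 0.
    q≢0 q≡0 = ↧≢0 t (ℤₚ.∣i∣≡0⇒i≡0 ([ (λ z → z) , (λ z → z) ]′ (ℕₚ.m*n≡0⇒m≡0∨n≡0 ∣ b ∣
      (ℕₚ.n≤0⇒n≡0 (subst (λ z → ∣ b ∣ * ∣ b ∣ ≤ 2 * ∣ z ∣) q≡0 (abs-square≤ b a))))))

  growth-phi : ∀ t X → t ≢ m1 → Ht X * Ht X * Ht X ≤ threshold (τ t) * Ht (phi t X)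
  growth-phi t X t≢-1 with e , num , den ← phi-coordinates t X | x , y , bez ← bézoutP1 X =
    subst₂ (λ h h′ → h * h * h ≤ threshold (τ t) * h′) (sym (Ht≡ X)) (sym (Ht≡ (phi t X)))
      (subst (λ k → _ ≤ k * (∣ nu (phi t X) ∣ ℕ.⊔ ∣ de (phi t X) ∣)) (sym (threshold≡ (τ t)))
          (Step.growth (↥ t) (↧ t) (nu X) (de X) (nu (phi t X)) (de (phi t X)) e x y (↧≢0 t) (sum-of-cubes≢0 t t≢-1) bez num den))

  1≤Ht : ∀ X → 1 ≤ Ht X
  1≤Ht nothing  = ℕₚ.≤-refl
  1≤Ht (just x) = 1≤τ x

  Big-phi : ∀ t X → t ≢ m1 → Big t X → Big t (phi t X)
  Big-phi t X t≢-1 big = ℕₚ.≤-trans big (ℕₚ.*-mono-≤ h≤h′ h≤h′)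
    where
    instance h²≢0 : ℕ.NonZero (Ht X * Ht X)
    h²≢0 = ℕ.>-nonZero (ℕₚ.*-mono-≤ (1≤Ht X) (1≤Ht X))
    h≤h′ : Ht X ≤ Ht (phi t X)
    h≤h′ = ℕₚ.*-cancelˡ-≤ (Ht X * Ht X) (ℕₚ.≤-trans (growth-phi t X t≢-1) (ℕₚ.*-monoˡ-≤ (Ht (phi t X)) big))

  -- An integral image would need H(X)² ≤ 4τ⁴, strictly below the threshold 128τ⁴.
  Big⇒phi-not-integer : ∀ t X {x} → t ≢ m1 → Big t X → phi t X ≡ just x → ¬ IsInt x
  Big⇒phi-not-integer t X {x} t≢-1 big φX≡x int
    with e , num , den ← phi-coordinates t X | p , q , bez ← bézoutP1 X =
    ℕₚ.<⇒≱ 4<128 (ℕₚ.≤-trans (subst (_≤ Ht X * Ht X) (threshold≡ (τ t)) big)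
        (subst (λ h → h * h ≤ 4 * (τ t * τ t * τ t * τ t)) (sym (Ht≡ X))
      (Step.integral⇒small (↥ t) (↧ t) (nu X) (de X) (nu (phi t X)) (de (phi t X)) e p q (↧≢0 t)
          (sum-of-cubes≢0 t t≢-1) bez num den
        (trans (cong de φX≡x) (cong +_ int)))))
    where
    T = τ t * τ t * τ t * τ t
    4<128 : 4 * T ℕ.< 128 * T
    4<128 = ℕₚ.*-monoˡ-< T {{ℕ.>-nonZero (ℕₚ.*-mono-≤ (ℕₚ.*-mono-≤ (ℕₚ.*-mono-≤ (1≤τ t) (1≤τ t)) (1≤τ t)) (1≤τ t))}}
        (ℕₚ.<ᵇ⇒< 4 128 _)

-- Finite enumerations, recurrence and finiteness of orbit counts

module Counting where
  open import Data.Nat using (_+_; _*_; _≤_; _<_)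
  open ℕₚ using (≤-trans; ≤-refl; ≤-reflexive)
  open import Data.Rational.Properties using (_≟_)
  open import Data.List.Relation.Unary.Unique.DecPropositional.Properties ℚₚ._≟_ using (deduplicate-!)

  length-cartesianProductWith : ∀ {A B C : Set} (f : A → B → C) xs ys →
      length (cartesianProductWith f xs ys) ≡ length xs * length ys
  length-cartesianProductWith f [] ys = refl
  length-cartesianProductWith f (x ∷ xs) ys = trans (length-++ (map (f x) ys))
    (cong₂ _+_ (length-map (f x) ys) (length-cartesianProductWith f xs ys))

  length-concatMap-≤ : ∀ {A B : Set} (f : A → List B) k xs → (∀ x → x ∈ xs → length (f x) ≤ k) →
      length (concatMap f xs) ≤ length xs * k
  length-concatMap-≤ f k [] _ = z≤n
  length-concatMap-≤ f k (x ∷ xs) fx≤k = ≤-trans (≤-reflexive (length-++ (f x)))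
    (ℕₚ.+-mono-≤ (fx≤k x (here refl)) (length-concatMap-≤ f k xs (λ y → fx≤k y ∘ there)))

  unique-⊆⇒length-≤ : ∀ {A : Set} (xs ys : List A) → Unique xs → (∀ {x} → x ∈ xs → x ∈ ys) → length xs ≤ length ys
  unique-⊆⇒length-≤ [] ys _ _ = z≤n
  unique-⊆⇒length-≤ (x ∷ xs) ys uniq@(_ ∷ uniq′) xs⊆ys with l , r , refl ← ∈-∃++ (xs⊆ys (here refl)) =
    ≤-trans (s≤s (unique-⊆⇒length-≤ xs (l ++ r) uniq′ avoid)) (≤-reflexive (sym (length-++-sucʳ l x r)))
    where
    avoid : ∀ {y} → y ∈ xs → y ∈ l ++ r
    avoid {y} y∈xs with ∈-++⁻ l (xs⊆ys (there y∈xs))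
    ... | inj₁ y∈l = ∈-++⁺ˡ y∈l
    ... | inj₂ (here refl) = ⊥-elim (Uniqueₚ.Unique[x∷xs]⇒x∉xs uniq y∈xs)
    ... | inj₂ (there y∈r) = ∈-++⁺ʳ l y∈r

  intsUpTo : ℕ → List ℤ
  intsUpTo T = map +_ (upTo (suc T)) ++ map -[1+_] (upTo T)

  length-intsUpTo : ∀ T → length (intsUpTo T) ≡ suc T + T
  length-intsUpTo T = trans (length-++ (map +_ (upTo (suc T))))
    (cong₂ _+_ (trans (length-map +_ (upTo (suc T))) (length-upTo (suc T))) (trans (length-map -[1+_] (upTo T)) (length-upTo T)))

  ∈-intsUpTo : ∀ {T} z → ∣ z ∣ ≤ T → z ∈ intsUpTo T
  ∈-intsUpTo (+ n) n≤T = ∈-++⁺ˡ (∈-map⁺ +_ (∈-upTo⁺ (s≤s n≤T)))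
  ∈-intsUpTo {T} -[1+ n ] n<T = ∈-++⁺ʳ (map +_ (upTo (suc T))) (∈-map⁺ -[1+_] (∈-upTo⁺ n<T))

  rationals : ℕ → ℕ → List ℚ
  rationals T D = cartesianProductWith (λ a d-1 → a ℚ./ suc d-1) (intsUpTo T) (upTo D)

  length-rationals : ∀ T D → length (rationals T D) ≡ (suc T + T) * D
  length-rationals T D = trans (length-cartesianProductWith _ (intsUpTo T) (upTo D))
      (cong₂ _*_ (length-intsUpTo T) (length-upTo D))

  ∈-rationals : ∀ t {T D} → ∣ ↥ t ∣ ≤ T → ↧ₙ t ≤ D → t ∈ rationals T D
  ∈-rationals t@(mkℚ a d-1 _) {T} {D} a≤T d≤D =
    subst (_∈ rationals T D) (ℚₚ.↥p/↧p≡p t) (∈-cartesianProductWith⁺ (λ a d-1 → a ℚ./ suc d-1) (∈-intsUpTo a a≤T) (∈-upTo⁺ d≤D))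

  ∈-rationals-Ht : ∀ t {T} → Ht (just t) ≤ T → t ∈ rationals T T
  ∈-rationals-Ht t h≤T = ∈-rationals t (ℕₚ.m⊔n≤o⇒m≤o _ _ h≤T) (ℕₚ.m⊔n≤o⇒n≤o _ _ h≤T)

  points : ℕ → List P1
  points W = nothing ∷ map just (rationals W W)

  ∈-points : ∀ X {W} → Ht X ≤ W → X ∈ points W
  ∈-points nothing  _ = here refl
  ∈-points (just x) h≤W = there (∈-map⁺ just (∈-rationals-Ht x h≤W))

  collision : ∀ {A : Set} (f : ℕ → A) (ps : List A) → (∀ i → i ≤ length ps → f i ∈ ps) →
              ∃₂ λ i j → i < j × j ≤ length ps × f i ≡ f j
  collision f ps mem
    with i , j , i<j , eq ← Finₚ.pigeonhole (ℕₚ.n<1+n (length ps)) (λ i → Any.index (mem (toℕ i) (ℕ.s≤s⁻¹ (Finₚ.toℕ<n i)))) =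
    toℕ i , toℕ j , i<j , bound j , trans (lookup-index (mem _ (bound i)))
        (trans (cong (lookup ps) eq) (sym (lookup-index (mem _ (bound j)))))
    where
    bound : ∀ (i : Fin (suc (length ps))) → toℕ i ≤ length ps
    bound i = ℕ.s≤s⁻¹ (Finₚ.toℕ<n i)

  -- Strong induction on n: beyond `length ps` two early values f i and f j coincide, and cutting
  -- out the loop between them gives f n = f (n - j + i) at a smaller index.
  recurrence : ∀ {A : Set} (f : ℕ → A) → (∀ i j → f i ≡ f j → f (suc i) ≡ f (suc j)) → (ps : List A) →
               ∀ n → (∀ i → i ≤ n → f i ∈ ps) → ∃ λ m → m ≤ length ps × f m ≡ f n
  recurrence f step ps = <-rec _ go
    where
    shift : ∀ k i j → f i ≡ f j → f (k + i) ≡ f (k + j)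
    shift zero i j eq = eq
    shift (suc k) i j eq = step (k + i) (k + j) (shift k i j eq)
    go : ∀ n → (∀ {k} → k < n → (∀ i → i ≤ k → f i ∈ ps) → ∃ λ m → m ≤ length ps × f m ≡ f k) →
         (∀ i → i ≤ n → f i ∈ ps) → ∃ λ m → m ≤ length ps × f m ≡ f n
    go n rec mem with n ℕ.≤? length ps
    ... | yes n≤ = n , n≤ , refl
    ... | no n≰ with i , j , i<j , j≤ , fi≡fj ← collision f ps (λ i i≤ → mem i (≤-trans i≤ (ℕₚ.<⇒≤ (ℕₚ.≰⇒> n≰))))
      = let n≡ = ℕₚ.m∸n+n≡m (≤-trans j≤ (ℕₚ.<⇒≤ (ℕₚ.≰⇒> n≰)))
            k = n ℕ.∸ j
            k+i<n = subst (k + i <_) n≡ (ℕₚ.+-monoʳ-< k i<j)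
            m , m≤ , fm≡ = rec k+i<n (λ l l≤ → mem l (≤-trans l≤ (ℕₚ.<⇒≤ k+i<n)))
        in m , m≤ , trans fm≡ (trans (shift k i j fi≡fj) (cong f n≡))

  Integral : P1 → Set
  Integral nothing  = ⊥
  Integral (just x) = IsInt x

  integral? : ∀ X → Dec (Integral X)
  integral? nothing  = no λ ()
  integral? (just x) = ↧ₙ x ℕ.≟ 1

  ∈-catMaybes⁻ : ∀ {A : Set} {x : A} xs → x ∈ catMaybes xs → just x ∈ xs
  ∈-catMaybes⁻ (just _ ∷ xs) (here refl) = here refl
  ∈-catMaybes⁻ (just _ ∷ xs) (there p)   = there (∈-catMaybes⁻ xs p)
  ∈-catMaybes⁻ (nothing ∷ xs) p          = there (∈-catMaybes⁻ xs p)

  ∈-catMaybes⁺ : ∀ {A : Set} {x : A} {xs} → just x ∈ xs → x ∈ catMaybes xs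
  ∈-catMaybes⁺ p = Any-catMaybes⁺ (Any.map (λ { refl → MAny.just refl }) p)

  open Dynamics

  module Orbit (t : ℚ) (X : P1) (t≢-1 : t ≢ m1) where
    f : ℕ → P1
    f n = iter n (phi t) X

    Big-iter : ∀ k i → Big t (f i) → Big t (f (k + i))
    Big-iter zero i big = big
    Big-iter (suc k) i big = Big-phi t (f (k + i)) t≢-1 (Big-iter k i big)

    not-Big⇒Ht≤ : ∀ {W} Y → threshold (τ t) ≤ W → ¬ Big t Y → Ht Y ≤ W
    not-Big⇒Ht≤ Y T≤W ¬big = ≤-trans (ℕₚ.m≤m*n (Ht Y) (Ht Y) {{ℕ.>-nonZero (1≤Ht Y)}}) (≤-trans (ℕₚ.<⇒≤ (ℕₚ.≰⇒> ¬big)) T≤W)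

    -- `Big` persists under φ_t, so a point that fails it has no predecessor in the orbit satisfying
    -- it. The whole initial segment then lies among the points of height at most W.
    recur : ∀ {W} → threshold (τ t) ≤ W → ∀ n → ¬ Big t (f n) → ∃ λ m → m ≤ length (points W) × f m ≡ f n
    recur {W} T≤W n ¬big = recurrence f (λ _ _ → cong (phi t)) (points W) n
      (λ i i≤n → ∈-points (f i) (not-Big⇒Ht≤ (f i) T≤W
          (λ big → ¬big (subst (Big t ∘ f) (ℕₚ.m∸n+n≡m i≤n) (Big-iter (n ℕ.∸ i) i big)))))

    -- An integer at index n + 1 shows that its predecessor is not `Big`, so `recur` moves that
    -- predecessor to an index at most `length (points W)`. Stepping forward again costs one more
    -- index, and the strict bound another: hence the 2.
    integer-early : ∀ {W} → threshold (τ t) ≤ W → ∀ n {x} → IsInt x → f n ≡ just x →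
                    ∃ λ m → m < 2 + length (points W) × f m ≡ just x
    integer-early T≤W zero int eq = 0 , s≤s z≤n , eq
    integer-early T≤W (suc n) int eq =
      let m , m≤ , fm≡fn = recur T≤W n (λ big → Big⇒phi-not-integer t (f n) t≢-1 big eq int)
      in suc m , s≤s (s≤s m≤) , trans (cong (phi t) fm≡fn) eq

    orbit-count : ∀ W → threshold (τ t) ≤ W → ∃ λ c → IntOrbitCount t X c × c ≤ 2 + length (points W)
    orbit-count W T≤W = length L , (L , deduplicate-! _ , (λ x → mk⇔ to from) , refl) , bound
      where
      n₀ = 2 + length (points W)
      early = catMaybes (map f (upTo n₀))
      int? : ∀ x → Dec (IsInt x)
      int? x = ↧ₙ x ℕ.≟ 1
      L : List ℚ
      L = deduplicate _≟_ (filter int? early)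
      to : ∀ {x} → x ∈ L → InIntOrbit t X x
      to x∈L = let x∈ , int = ∈-filter⁻ int? {xs = early} (∈-deduplicate⁻ _≟_ (filter int? early) x∈L)
                   n , _ , eq = ∈-map⁻ f {xs = upTo n₀} (∈-catMaybes⁻ (map f (upTo n₀)) x∈)
               in int , n , sym eq
      from : ∀ {x} → InIntOrbit t X x → x ∈ L
      from (int , n , eq) = let m , m< , fm≡ = integer-early T≤W n int eq in
        ∈-deduplicate⁺ _≟_ (∈-filter⁺ int?
            (∈-catMaybes⁺ (subst (_∈ map f (upTo n₀)) fm≡ (∈-map⁺ f {m} {upTo n₀} (∈-upTo⁺ m<)))) int)
      bound : length L ≤ n₀
      bound = ≤-trans (length-deduplicate _≟_ (filter int? early)) (≤-trans (length-filter int? early)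
        (≤-trans (length-mapMaybe f (upTo n₀)) (≤-reflexive (length-upTo n₀))))

    Big⇒iter≡0 : Big t X → ∀ n {x} → IsInt x → f n ≡ just x → X ≡ just x
    Big⇒iter≡0 big zero int eq = eq
    Big⇒iter≡0 big (suc n) int eq =
        ⊥-elim (Big⇒phi-not-integer t (f n) t≢-1 (subst (Big t ∘ f) (ℕₚ.+-identityʳ n) (Big-iter n 0 big)) eq int)

    Big⇒count-≤1 : ∀ {c} → Big t X → IntOrbitCount t X c → c ≤ 1
    Big⇒count-≤1 big (L , uniq , iff , refl) = distinct L uniq (λ x∈L → let int , n , eq = Equivalence.to (iff _) x∈L in
        Big⇒iter≡0 big n int eq)
      where
      distinct : ∀ L → Unique L → (∀ {x} → x ∈ L → X ≡ just x) → length L ≤ 1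
      distinct [] _ _ = z≤n
      distinct (_ ∷ []) _ _ = ≤-refl
      distinct (x ∷ y ∷ L) ((x≢y ∷ _) ∷ _) all =
          ⊥-elim (x≢y (just-injective (trans (sym (all (here refl))) (all (there (here refl))))))

    Big⇒count≡0 : ∀ {c} → Big t X → ¬ Integral X → IntOrbitCount t X c → c ≡ 0
    Big⇒count≡0 big ¬int (L , uniq , iff , refl) = empty L (λ x∈L → let int , n , eq = Equivalence.to (iff _) x∈L in
        ¬int (subst Integral (sym (Big⇒iter≡0 big n int eq)) int))
      where
      empty : ∀ (L : List ℚ) → (∀ {x} → x ∉ L) → length L ≡ 0
      empty [] _ = refl
      empty (x ∷ L) none = ⊥-elim (none (here refl))

-- Binary forms, clearing of denominators and homogenisation

module Forms where
  open import Data.Nat using (_≤_; _<_)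
  open Ints
  open Rationals
  open import Data.Integer using (_+_; _*_; _^_)

  -- hev d c a b = Σ_{i ≤ d} c i · aⁱ · b^(d ∸ i)
  hev : ℕ → (ℕ → ℤ) → ℤ → ℤ → ℤ
  hev zero    c a b = c 0
  hev (suc d) c a b = c 0 * b ^ suc d + a * hev d (c ∘ suc) a b

  -- The recursion of `hev` splits off the pure power of b; the estimates for large a and the
  -- divisibility argument need the pure power of a instead.
  hev-top : ∀ d c a b → hev (suc d) c a b ≡ b * hev d c a b + c (suc d) * a ^ suc d
  hev-top zero c a b = id (c 0) (c 1) a b
    where
    id : ∀ c₀ c₁ a b → c₀ * (b * 1ℤ) + a * c₁ ≡ b * c₀ + c₁ * (a * 1ℤ)
    id = ℤS.solve-∀
  hev-top (suc d) c a b = trans (cong (λ z → c 0 * b ^ suc (suc d) + a * z) (hev-top d (c ∘ suc) a b))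
      (id (c 0) (c (suc (suc d))) a b (b ^ d) (a ^ d) (hev d (c ∘ suc) a b))
    where
    id : ∀ c₀ c₂ a b p q z → c₀ * (b * (b * p)) + a * (b * z + c₂ * (a * q)) ≡ b * (c₀ * (b * p) + a * z) + c₂ * (a * (a * q))
    id = ℤS.solve-∀

  hev-zero : ∀ d c a b → (∀ i → c i ≡ 0ℤ) → hev d c a b ≡ 0ℤ
  hev-zero zero c a b c≡0 = c≡0 0
  hev-zero (suc d) c a b c≡0 = trans
      (cong₂ (λ x y → x * b ^ suc d + a * y) (c≡0 0) (hev-zero d (c ∘ suc) a b (c≡0 ∘ suc)))
      (trans (ℤₚ.+-identityˡ (a * 0ℤ)) (ℤₚ.*-zeroʳ a))

  norm : ℕ → (ℕ → ℤ) → ℕ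
  norm zero    c = ∣ c 0 ∣
  norm (suc d) c = ∣ c 0 ∣ ℕ.+ norm d (c ∘ suc)

  abs-^ : ∀ z n → ∣ z ^ n ∣ ≡ ∣ z ∣ ℕ.^ n
  abs-^ z zero    = refl
  abs-^ z (suc n) = trans (ℤₚ.abs-* z (z ^ n)) (cong (∣ z ∣ ℕ.*_) (abs-^ z n))

  ∣hev∣≤ : ∀ d c a b {H} → ∣ a ∣ ≤ H → ∣ b ∣ ≤ H → ∣ hev d c a b ∣ ≤ norm d c ℕ.* H ℕ.^ d
  ∣hev∣≤ zero c a b a≤H b≤H = ℕₚ.≤-reflexive (sym (ℕₚ.*-identityʳ ∣ c 0 ∣))
  ∣hev∣≤ (suc d) c a b {H} a≤H b≤H = ℕₚ.≤-trans
      (abs-+-≤ (c 0 * b ^ suc d) (a * hev d (c ∘ suc) a b)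
        (abs-*-≤ (c 0) (b ^ suc d) ℕₚ.≤-refl (ℕₚ.≤-trans (ℕₚ.≤-reflexive (abs-^ b (suc d))) (ℕₚ.^-monoˡ-≤ (suc d) b≤H)))
        (abs-*-≤ a (hev d (c ∘ suc) a b) a≤H (∣hev∣≤ d (c ∘ suc) a b a≤H b≤H)))
      (ℕₚ.≤-reflexive (id ∣ c 0 ∣ H (H ℕ.^ d) (norm d (c ∘ suc))))
    where
    id : ∀ c H p N → c ℕ.* (H ℕ.* p) ℕ.+ H ℕ.* (N ℕ.* p) ≡ (c ℕ.+ N) ℕ.* (H ℕ.* p)
    id = ℕS.solve-∀

  Clears : ℤ → Poly → (ℕ → ℤ) → Set
  Clears s p c = ∀ i → ι s ℚ.* coeff p i ≡ ι (c i)

  clears-scale : ∀ k {s p c} → Clears s p c → Clears (k * s) p (λ i → k * c i)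
  clears-scale k {s} {p} {c} cl i = trans (cong (ℚ._* coeff p i) (ι-* k s)) (trans (ℚₚ.*-assoc (ι k) (ι s) (coeff p i))
    (trans (cong (λ z → ι k ℚ.* z) (cl i)) (sym (ι-* k (c i)))))

  clear : ∀ p → ∃ λ s → s ≢ 0ℤ × ∃ (Clears s p)
  clear [] = 1ℤ , (λ ()) , (λ _ → 0ℤ) , λ _ → ℚₚ.*-zeroʳ (ι 1ℤ)
  clear (x@record{} ∷ p) with s , s≢0 , c , cl ← clear p = ↧ x * s , *-≢0 {↧ x} {s} (λ ()) s≢0 , c′ , cl′
    where
    c′ : ℕ → ℤ
    c′ zero = s * ↥ x
    c′ (suc i) = ↧ x * c i
    cl′ : Clears (↧ x * s) (x ∷ p) c′
    cl′ zero = trans (cong (ℚ._* x) (ι-* (↧ x) s))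
        (trans (id (ι (↧ x)) (ι s) x) (trans (cong (λ z → ι s ℚ.* z) (↧*p≡↥ x)) (sym (ι-* s (↥ x)))))
      where
      id : ∀ v s x → v ℚ.* s ℚ.* x ≡ s ℚ.* (v ℚ.* x)
      id = RS.solve-∀ ℚ-ring
    cl′ (suc i) = clears-scale (↧ x) {s} {p} {c} cl i

  -- One multiplier serves all the polynomials, so that scaling numerator and denominator of β
  -- leaves their quotient unchanged.
  clear-all : ∀ ps → ∃ λ s → s ≢ 0ℤ × All (λ p → ∃ (Clears s p)) ps
  clear-all [] = 1ℤ , (λ ()) , []
  clear-all (p ∷ ps) with s , s≢0 , c , cl ← clear p | k , k≢0 , cls ← clear-all ps =
    k * s , *-≢0 k≢0 s≢0 , (_ , clears-scale k {s} {p} {c} cl) ∷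
      All.map (λ { {q} (c′ , cl′) → subst (λ z → ∃ (Clears z q)) (ℤₚ.*-comm s k) (_ , clears-scale s {k} {q} {c′} cl′) }) cls

  eval-zero : ∀ p t → (∀ i → coeff p i ≡ 0ℚ) → eval p t ≡ 0ℚ
  eval-zero [] t _ = refl
  eval-zero (x ∷ p) t p≡0 = trans (cong₂ (λ y z → y ℚ.+ t ℚ.* z) (p≡0 0) (eval-zero p t (p≡0 ∘ suc)))
      (trans (ℚₚ.+-identityˡ (t ℚ.* 0ℚ)) (ℚₚ.*-zeroʳ t))

  -- The degree bound is stated through vanishing coefficients instead of list length, because a
  -- coefficient list may end in zeros and d is the common degree of two polynomials.
  hev-eval : ∀ d p {s c} t → Clears s p c → (∀ i → d < i → coeff p i ≡ 0ℚ) →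
             ι (hev d c (↥ t) (↧ t)) ≡ ι s ℚ.* ι (↧ t ^ d) ℚ.* eval p t
  hev-eval d [] {s} {c} t cl _ = trans
      (cong ι (hev-zero d c (↥ t) (↧ t) (λ i → ι-injective (trans (sym (cl i)) (ℚₚ.*-zeroʳ (ι s))))))
    (sym (ℚₚ.*-zeroʳ (ι s ℚ.* ι (↧ t ^ d))))
  hev-eval zero (x ∷ p) {s} {c} t cl big =
      trans (sym (cl 0)) (trans (id (ι s) x t)
      (cong (λ z → ι s ℚ.* 1ℚ ℚ.* (x ℚ.+ t ℚ.* z)) (sym (eval-zero p t (λ i → big (suc i) (s≤s z≤n))))))
    where
    id : ∀ s x t → s ℚ.* x ≡ s ℚ.* 1ℚ ℚ.* (x ℚ.+ t ℚ.* 0ℚ)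
    id = RS.solve-∀ ℚ-ring
  hev-eval (suc d) (x ∷ p) {s} {c} t cl big = begin
    ι (c 0 * (b * b ^ d) + a * hev d (c ∘ suc) a b)
      ≡⟨ trans (ι-+ (c 0 * (b * b ^ d)) _)
          (cong₂ ℚ._+_ (trans (ι-* (c 0) (b * b ^ d)) (cong (λ z → ι (c 0) ℚ.* z) (ι-* b (b ^ d)))) (ι-* a _)) ⟩
    ι (c 0) ℚ.* (ι b ℚ.* ι (b ^ d)) ℚ.+ ι a ℚ.* ι (hev d (c ∘ suc) a b)
      ≡⟨ cong₂ (λ y z → y ℚ.* (ι b ℚ.* ι (b ^ d)) ℚ.+ ι a ℚ.* z) (sym (cl 0))
          (hev-eval d p {s} {c ∘ suc} t (cl ∘ suc) (λ i d<i → big (suc i) (s≤s d<i))) ⟩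
    ι s ℚ.* x ℚ.* (ι b ℚ.* ι (b ^ d)) ℚ.+ ι a ℚ.* (ι s ℚ.* ι (b ^ d) ℚ.* eval p t)
      ≡⟨ cong (λ z → ι s ℚ.* x ℚ.* (ι b ℚ.* ι (b ^ d)) ℚ.+ z ℚ.* (ι s ℚ.* ι (b ^ d) ℚ.* eval p t)) (sym (↧*p≡↥ t)) ⟩
    ι s ℚ.* x ℚ.* (ι b ℚ.* ι (b ^ d)) ℚ.+ ι b ℚ.* t ℚ.* (ι s ℚ.* ι (b ^ d) ℚ.* eval p t)
      ≡⟨ id (ι s) x (ι b) (ι (b ^ d)) t (eval p t) ⟩
    ι s ℚ.* (ι b ℚ.* ι (b ^ d)) ℚ.* (x ℚ.+ t ℚ.* eval p t)
      ≡⟨ cong (λ z → ι s ℚ.* z ℚ.* (x ℚ.+ t ℚ.* eval p t)) (sym (ι-* b (b ^ d))) ⟩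
    ι s ℚ.* ι (b * b ^ d) ℚ.* (x ℚ.+ t ℚ.* eval p t) ∎
    where
    open ≡-Reasoning
    a = ↥ t
    b = ↧ t
    id : ∀ s x b q t z → s ℚ.* x ℚ.* (b ℚ.* q) ℚ.+ b ℚ.* t ℚ.* (s ℚ.* q ℚ.* z) ≡ s ℚ.* (b ℚ.* q) ℚ.* (x ℚ.+ t ℚ.* z)
    id = RS.solve-∀ ℚ-ring

  eval-+P : ∀ p q t → eval (p +P q) t ≡ eval p t ℚ.+ eval q t
  eval-+P [] q t = sym (ℚₚ.+-identityˡ (eval q t))
  eval-+P (x ∷ p) [] t = sym (ℚₚ.+-identityʳ _)
  eval-+P (x ∷ p) (y ∷ q) t = trans (cong (λ z → x ℚ.+ y ℚ.+ t ℚ.* z) (eval-+P p q t)) (id x y t (eval p t) (eval q t))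
    where
    id : ∀ x y t p q → x ℚ.+ y ℚ.+ t ℚ.* (p ℚ.+ q) ≡ x ℚ.+ t ℚ.* p ℚ.+ (y ℚ.+ t ℚ.* q)
    id = RS.solve-∀ ℚ-ring

  eval-scale : ∀ k p t → eval (scale k p) t ≡ k ℚ.* eval p t
  eval-scale k [] t = sym (ℚₚ.*-zeroʳ k)
  eval-scale k (x ∷ p) t = trans (cong (λ z → k ℚ.* x ℚ.+ t ℚ.* z) (eval-scale k p t)) (id k x t (eval p t))
    where
    id : ∀ k x t p → k ℚ.* x ℚ.+ t ℚ.* (k ℚ.* p) ≡ k ℚ.* (x ℚ.+ t ℚ.* p)
    id = RS.solve-∀ ℚ-ring

  eval-*P : ∀ p q t → eval (p *P q) t ≡ eval p t ℚ.* eval q t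
  eval-*P [] q t = sym (ℚₚ.*-zeroˡ (eval q t))
  eval-*P (x ∷ p) q t = trans (eval-+P (scale x q) (0ℚ ∷ (p *P q)) t)
      (trans (cong₂ (λ y z → y ℚ.+ (0ℚ ℚ.+ t ℚ.* z)) (eval-scale x q t) (eval-*P p q t)) (id x t (eval p t) (eval q t)))
    where
    id : ∀ x t p q → x ℚ.* q ℚ.+ (0ℚ ℚ.+ t ℚ.* (p ℚ.* q)) ≡ (x ℚ.+ t ℚ.* p) ℚ.* q
    id = RS.solve-∀ ℚ-ring

  eval-≈P : ∀ p q t → p ≈P q → eval p t ≡ eval q t
  eval-≈P [] q t p≈q = sym (eval-zero q t (sym ∘ p≈q))
  eval-≈P (x ∷ p) [] t p≈q = eval-zero (x ∷ p) t p≈q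
  eval-≈P (x ∷ p) (y ∷ q) t p≈q = cong₂ (λ w z → w ℚ.+ t ℚ.* z) (p≈q 0) (eval-≈P p q t (p≈q ∘ suc))

  coeff-beyond : ∀ p i → length p ≤ i → coeff p i ≡ 0ℚ
  coeff-beyond [] i _ = refl
  coeff-beyond (x ∷ p) (suc i) (s≤s l≤i) = coeff-beyond p i l≤i

  greatest : ∀ {P : ℕ → Set} → (∀ i → Dec (P i)) → ∀ n → (∀ i → n < i → ¬ P i) → ∃ P → ∃ λ d → P d × (∀ i → d < i → ¬ P i)
  greatest P? n none ex with P? n
  ... | yes pn = n , pn , none
  greatest P? zero none (zero , p) | no ¬p₀ = ⊥-elim (¬p₀ p)
  greatest P? zero none (suc i , p) | no ¬p₀ = ⊥-elim (none (suc i) (s≤s z≤n) p)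
  greatest {P} P? (suc n) none ex | no ¬pn = greatest P? n none′ ex
    where
    none′ : ∀ i → n < i → ¬ P i
    none′ i n<i with ℕₚ.m≤n⇒m<n∨m≡n n<i
    ... | inj₁ sn<i = none i sn<i
    ... | inj₂ refl = ¬pn

  bézout-^ : ∀ {x y a b} → x * a + y * b ≡ 1ℤ → ∀ n → ∃₂ λ x′ y′ → x′ * a ^ n + y′ * b ≡ 1ℤ
  bézout-^ bez zero = 1ℤ , 0ℤ , refl
  bézout-^ {x} {y} {a} {b} bez (suc n) with x′ , y′ , bez′ ← bézout-^ {x} {y} {a} {b} bez n =
    x′ * x , x′ * a ^ n * y + y′ * (x * a + y * b) , trans (id x y x′ y′ a b (a ^ n)) (cong₂ _*_ bez′ bez)
    where
    id : ∀ x y x′ y′ a b p → x′ * x * (a * p) + (x′ * p * y + y′ * (x * a + y * b)) * b ≡ (x′ * p + y′ * b) * (x * a + y * b)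
    id = ℤS.solve-∀

-- An integral homogeneous model of β

module Heights where
  open import Data.Nat using (_≤_; _<_)
  open import Data.Rational.Properties using (_≟_)
  open Ints
  open Rationals
  open Forms
  open Dynamics
  open Counting
  open import Data.Integer using (_+_; _*_; _^_)

  -- F and G are numerator and denominator of β, homogenised to the common degree d = deg β; A and B
  -- are the homogenised Bézout cofactors. As d is the larger of the two degrees, only one of F and
  -- G is sure to keep its leading coefficient, hence the disjunction in `top≢0`.
  record Model (β : RatFun) : Set where
    field
      d′ n   : ℕ
      s      : ℤ
      F G A B : ℕ → ℤ
    d : ℕ
    d = suc d′
    field
      s≢0    : s ≢ 0ℤ
      3≤d    : 3 ≤ d
      F-eval : ∀ t → ι (hev d F (↥ t) (↧ t)) ≡ ι s ℚ.* ι (↧ t ^ d) ℚ.* eval (RatFun.num β) t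
      G-eval : ∀ t → ι (hev d G (↥ t) (↧ t)) ≡ ι s ℚ.* ι (↧ t ^ d) ℚ.* eval (RatFun.den β) t
      bezout : ∀ t → hev n A (↥ t) (↧ t) * hev d F (↥ t) (↧ t) + hev n B (↥ t) (↧ t) * hev d G (↥ t)
          (↧ t) ≡ s * s * ↧ t ^ (n ℕ.+ d)
      top≢0  : F d ≢ 0ℤ ⊎ G d ≢ 0ℤ
      G≢0    : ∃ λ i → i ≤ d × G i ≢ 0ℤ

  clears-≢0 : ∀ {s p c} i → s ≢ 0ℤ → Clears s p c → coeff p i ≢ 0ℚ → c i ≢ 0ℤ
  clears-≢0 {s} {p} {c} i s≢0 cl x≢0 ci≡0 =
    [ s≢0 , x≢0 ∘ ℚₚ.↥p≡0⇒p≡0 x ]′ (ℤₚ.i*j≡0⇒i≡0∨j≡0 s (ι-injective (begin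
      ι (s * ↥ x) ≡⟨ ι-* s (↥ x) ⟩
      ι s ℚ.* ι (↥ x) ≡⟨ cong (λ z → ι s ℚ.* z) (sym (↧*p≡↥ x)) ⟩
      ι s ℚ.* (ι (↧ x) ℚ.* x) ≡⟨ id (ι s) (ι (↧ x)) x ⟩
      ι (↧ x) ℚ.* (ι s ℚ.* x) ≡⟨ cong (λ z → ι (↧ x) ℚ.* z) (trans (cl i) (cong ι ci≡0)) ⟩
      ι (↧ x) ℚ.* 0ℚ ≡⟨ ℚₚ.*-zeroʳ (ι (↧ x)) ⟩
      0ℚ ∎)))
    where
    open ≡-Reasoning
    x = coeff p i
    id : ∀ s v x → s ℚ.* (v ℚ.* x) ≡ v ℚ.* (s ℚ.* x)
    id = RS.solve-∀ ℚ-ring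

  model : ∀ β → DegRatFunGe3 β → Model β
  model β deg = build (greatest nz? (length f ℕ.⊔ length g) beyond nonzero) (clear-all (f ∷ g ∷ p ∷ q ∷ []))
    where
    open RatFun β renaming (num to f; den to g)
    p = proj₁ cop
    q = proj₁ (proj₂ cop)
    n = length p ℕ.⊔ length q
    nz : ℕ → Set
    nz i = coeff f i ≢ 0ℚ ⊎ coeff g i ≢ 0ℚ
    nz? : ∀ i → Dec (nz i)
    nz? i = ¬? (coeff f i ≟ 0ℚ) ⊎-dec ¬? (coeff g i ≟ 0ℚ)
    beyond : ∀ i → length f ℕ.⊔ length g < i → ¬ nz i
    beyond i l<i (inj₁ fi≢0) = fi≢0 (coeff-beyond f i (ℕₚ.m⊔n≤o⇒m≤o _ _ (ℕₚ.<⇒≤ l<i)))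
    beyond i l<i (inj₂ gi≢0) = gi≢0 (coeff-beyond g i (ℕₚ.m⊔n≤o⇒n≤o (length f) _ (ℕₚ.<⇒≤ l<i)))
    high : ∃ λ i → 3 ≤ i × nz i
    high = [ (λ (i , 3≤i , fi≢0) → i , 3≤i , inj₁ fi≢0) , (λ (i , 3≤i , gi≢0) → i , 3≤i , inj₂ gi≢0) ]′ deg
    nonzero : ∃ nz
    nonzero = proj₁ high , proj₂ (proj₂ high)
    bound-by : ∀ {d i} → (∀ i → d < i → ¬ nz i) → nz i → i ≤ d
    bound-by {d} {i} none nzi = ℕₚ.≮⇒≥ (λ d<i → none i d<i nzi)
    bez : ∀ t → eval p t ℚ.* eval f t ℚ.+ eval q t ℚ.* eval g t ≡ 1ℚ
    bez t = trans (sym (trans (eval-+P (p *P f) (q *P g) t) (cong₂ ℚ._+_ (eval-*P p f t) (eval-*P q g t))))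
      (trans (eval-≈P ((p *P f) +P (q *P g)) (1ℚ ∷ []) t (proj₂ (proj₂ cop)))
          (trans (cong (λ z → 1ℚ ℚ.+ z) (ℚₚ.*-zeroʳ t)) (ℚₚ.+-identityʳ 1ℚ)))
    build : (∃ λ d → nz d × (∀ i → d < i → ¬ nz i)) → (∃ λ s → s ≢ 0ℤ × All (λ p → ∃ (Clears s p)) (f ∷ g ∷ p ∷ q ∷ [])) → Model β
    build (zero , _ , none) _ = ⊥-elim (ℕₚ.<⇒≱ (s≤s z≤n) (ℕₚ.≤-trans (proj₁ (proj₂ high)) (bound-by none (proj₂ (proj₂ high)))))
    build (suc d′ , top , none) (s , s≢0 , (F , clF) ∷ (G , clG) ∷ (A , clA) ∷ (B , clB) ∷ []) = record
      { d′ = d′ ; n = n ; s = s ; F = F ; G = G ; A = A ; B = B ; s≢0 = s≢0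
      ; 3≤d = ℕₚ.≤-trans (proj₁ (proj₂ high)) (bound-by none (proj₂ (proj₂ high)))
      ; F-eval = F-eval
      ; G-eval = G-eval
      ; bezout = bezout
      ; top≢0 = Sum.map (clears-≢0 {s} {f} {F} d s≢0 clF) (clears-≢0 {s} {g} {G} d s≢0 clG) top
      ; G≢0 = let i , gi≢0 = den≢0 in i , bound-by none (inj₂ gi≢0) , clears-≢0 {s} {g} {G} i s≢0 clG gi≢0
      }
      where
      d = suc d′
      F-eval : ∀ t → ι (hev d F (↥ t) (↧ t)) ≡ ι s ℚ.* ι (↧ t ^ d) ℚ.* eval f t
      F-eval t = hev-eval d f {s} {F} t clF (λ i d<i → decidable-stable (coeff f i ≟ 0ℚ) (none i d<i ∘ inj₁))
      G-eval : ∀ t → ι (hev d G (↥ t) (↧ t)) ≡ ι s ℚ.* ι (↧ t ^ d) ℚ.* eval g t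
      G-eval t = hev-eval d g {s} {G} t clG (λ i d<i → decidable-stable (coeff g i ≟ 0ℚ) (none i d<i ∘ inj₂))
      bezout : ∀ t → hev n A (↥ t) (↧ t) * hev d F (↥ t) (↧ t) + hev n B (↥ t) (↧ t) * hev d G (↥ t)
          (↧ t) ≡ s * s * ↧ t ^ (n ℕ.+ d)
      bezout t = ι-injective (begin
        ι (Av * Fv + Bv * Gv) ≡⟨ trans (ι-+ (Av * Fv) (Bv * Gv)) (cong₂ ℚ._+_ (ι-* Av Fv) (ι-* Bv Gv)) ⟩
        ι Av ℚ.* ι Fv ℚ.+ ι Bv ℚ.* ι Gv
          ≡⟨ cong₂ ℚ._+_ (cong₂ ℚ._*_ (hev-eval n p {s} {A} t clA
              (λ i n<i → coeff-beyond p i (ℕₚ.m⊔n≤o⇒m≤o _ _ (ℕₚ.<⇒≤ n<i)))) (F-eval t))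
                         (cong₂ ℚ._*_ (hev-eval n q {s} {B} t clB
                             (λ i n<i → coeff-beyond q i (ℕₚ.m⊔n≤o⇒n≤o (length p) _ (ℕₚ.<⇒≤ n<i)))) (G-eval t)) ⟩
        ι s ℚ.* bⁿ ℚ.* eval p t ℚ.* (ι s ℚ.* bᵈ ℚ.* eval f t) ℚ.+ ι s ℚ.* bⁿ ℚ.* eval q t ℚ.* (ι s ℚ.* bᵈ ℚ.* eval g t)
          ≡⟨ id (ι s) bⁿ bᵈ (eval p t) (eval f t) (eval q t) (eval g t) ⟩
        ι s ℚ.* ι s ℚ.* (bⁿ ℚ.* bᵈ) ℚ.* (eval p t ℚ.* eval f t ℚ.+ eval q t ℚ.* eval g t)
          ≡⟨ trans (cong (λ z → ι s ℚ.* ι s ℚ.* (bⁿ ℚ.* bᵈ) ℚ.* z) (bez t)) (ℚₚ.*-identityʳ _) ⟩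
        ι s ℚ.* ι s ℚ.* (bⁿ ℚ.* bᵈ) ≡⟨ cong₂ ℚ._*_ (sym (ι-* s s))
            (trans (sym (ι-* (b ^ n) (b ^ d))) (cong ι (sym (ℤₚ.^-distribˡ-+-* b n d)))) ⟩
        ι (s * s) ℚ.* ι (b ^ (n ℕ.+ d)) ≡⟨ sym (ι-* (s * s) (b ^ (n ℕ.+ d))) ⟩
        ι (s * s * b ^ (n ℕ.+ d)) ∎)
        where
        open ≡-Reasoning
        b = ↧ t
        Fv = hev d F (↥ t) (↧ t)
        Gv = hev d G (↥ t) (↧ t)
        Av = hev n A (↥ t) (↧ t)
        Bv = hev n B (↥ t) (↧ t)
        bⁿ = ι (b ^ n)
        bᵈ = ι (b ^ d)
        id : ∀ s x y p f q g → s ℚ.* x ℚ.* p ℚ.* (s ℚ.* y ℚ.* f) ℚ.+ s ℚ.* x ℚ.* q ℚ.* (s ℚ.* y ℚ.* g) ≡ s ℚ.* s ℚ.*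
            (x ℚ.* y) ℚ.* (p ℚ.* f ℚ.+ q ℚ.* g)
        id = RS.solve-∀ ℚ-ring

-- Comparison of the heights of t and β(t)

module HeightBounds where
  open import Data.Nat using (_≤_; _<_)
  open import Data.Rational.Properties using (_≟_)
  open Ints
  open Rationals
  open Forms
  open Dynamics
  open Counting
  open Heights
  open import Data.Integer using (_+_; _*_; _^_; _-_)

  -- Since a^d and b are coprime, the leading coefficient c lies in the ideal generated by F = b·F₁
  -- + c·a^d and b. With e dividing F and w·b^m, `descent` turns the power of b into a power of c,
  -- which does not depend on t.
  cofactor : ∀ {a b x y e} Fv Gv Av Bv w F₁ c m d → x * a + y * b ≡ 1ℤ → Fv ≡ b * F₁ + c * a ^ d →
             Av * Fv + Bv * Gv ≡ w * b ^ m → e ∣ Fv → e ∣ Gv → e ∣ w * c ^ m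
  cofactor {a} {b} {x} {y} {e} Fv Gv Av Bv w F₁ c m d bez top bezout e∣F e∣G with x′ , y′ ,
      bez′ ← bézout-^ {x} {y} {a} {b} bez d =
    descent m e w Fv b c x′ (c * y′ - x′ * F₁) c≡ (∣n⇒∣m*n w e∣F)
      (subst (e ∣_) bezout (∣m∣n⇒∣m+n (∣n⇒∣m*n Av e∣F) (∣n⇒∣m*n Bv e∣G)))
    where
    id : ∀ c x′ y′ b p F₁ → c * (x′ * p + y′ * b) ≡ x′ * (b * F₁ + c * p) + (c * y′ - x′ * F₁) * b
    id = ℤS.solve-∀
    c≡ : c ≡ x′ * Fv + (c * y′ - x′ * F₁) * b
    c≡ = trans (sym (trans (cong (c *_) bez′) (ℤₚ.*-identityʳ c)))
        (trans (id c x′ y′ b (a ^ d) F₁) (cong (λ z → x′ * z + (c * y′ - x′ * F₁) * b) (sym top)))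

  ^-≢0 : ∀ {c} m → c ≢ 0ℤ → c ^ m ≢ 0ℤ
  ^-≢0 zero _ ()
  ^-≢0 {c} (suc m) c≢0 = *-≢0 {c} {c ^ m} c≢0 (^-≢0 m c≢0)

  ^-distribʳ-* : ∀ m n k → (m ℕ.* n) ℕ.^ k ≡ m ℕ.^ k ℕ.* n ℕ.^ k
  ^-distribʳ-* m n zero    = refl
  ^-distribʳ-* m n (suc k) = trans (cong (m ℕ.* n ℕ.*_) (^-distribʳ-* m n k)) (id m n (m ℕ.^ k) (n ℕ.^ k))
    where
    id : ∀ m n p q → m ℕ.* n ℕ.* (p ℕ.* q) ≡ m ℕ.* p ℕ.* (n ℕ.* q)
    id = ℕS.solve-∀

  -- The Bézout identity bounds b^(n+d), and b is at least τ/L; the cofactors A and B cost only τⁿ,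
  -- which cancels.
  lower-near : ∀ {τ b L n d h N W} → 1 ≤ τ → τ ≤ L ℕ.* b → b ℕ.^ (n ℕ.+ d) ≤ W → W ≤ N ℕ.* τ ℕ.^ n ℕ.* h →
               τ ℕ.^ d ≤ L ℕ.^ (n ℕ.+ d) ℕ.* N ℕ.* h
  lower-near {τ} {b} {L} {n} {d} {h} {N} {W} 1≤τ τ≤Lb b≤W W≤ =
      ℕₚ.*-cancelˡ-≤ (τ ℕ.^ n) {{ℕₚ.m^n≢0 τ n {{ℕ.>-nonZero 1≤τ}}}} (begin
    τ ℕ.^ n ℕ.* τ ℕ.^ d ≡⟨ sym (ℕₚ.^-distribˡ-+-* τ n d) ⟩
    τ ℕ.^ (n ℕ.+ d) ≤⟨ ℕₚ.^-monoˡ-≤ (n ℕ.+ d) τ≤Lb ⟩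
    (L ℕ.* b) ℕ.^ (n ℕ.+ d) ≡⟨ ^-distribʳ-* L b (n ℕ.+ d) ⟩
    L ℕ.^ (n ℕ.+ d) ℕ.* b ℕ.^ (n ℕ.+ d) ≤⟨ ℕₚ.*-monoʳ-≤ (L ℕ.^ (n ℕ.+ d)) (ℕₚ.≤-trans b≤W W≤) ⟩
    L ℕ.^ (n ℕ.+ d) ℕ.* (N ℕ.* τ ℕ.^ n ℕ.* h) ≡⟨ id (L ℕ.^ (n ℕ.+ d)) N (τ ℕ.^ n) h ⟩
    τ ℕ.^ n ℕ.* (L ℕ.^ (n ℕ.+ d) ℕ.* N ℕ.* h) ∎)
    where
    open ℕₚ.≤-Reasoning
    id : ∀ l N p h → l ℕ.* (N ℕ.* p ℕ.* h) ≡ p ℕ.* (l ℕ.* N ℕ.* h)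
    id = ℕS.solve-∀

  -- The error term b·N·p is at most half of a·p, so it can be absorbed after doubling.
  lower-far : ∀ {a b N p h} → (1 ℕ.+ 2 ℕ.* N) ℕ.* b ≤ a → a ℕ.* p ≤ h ℕ.+ b ℕ.* (N ℕ.* p) → a ℕ.* p ≤ 2 ℕ.* h
  lower-far {a} {b} {N} {p} {h} Lb≤a ap≤ = ℕₚ.+-cancelˡ-≤ (a ℕ.* p) _ _ (begin
    a ℕ.* p ℕ.+ a ℕ.* p ≤⟨ ℕₚ.+-mono-≤ ap≤ ap≤ ⟩
    h ℕ.+ b ℕ.* (N ℕ.* p) ℕ.+ (h ℕ.+ b ℕ.* (N ℕ.* p)) ≡⟨ id h b N p ⟩
    2 ℕ.* N ℕ.* b ℕ.* p ℕ.+ 2 ℕ.* h ≤⟨ ℕₚ.+-monoˡ-≤ (2 ℕ.* h) (ℕₚ.*-monoˡ-≤ p (ℕₚ.≤-trans (ℕₚ.m≤n+m (2 ℕ.* N ℕ.* b) b) Lb≤a)) ⟩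
    a ℕ.* p ℕ.+ 2 ℕ.* h ∎)
    where
    open ℕₚ.≤-Reasoning
    id : ∀ h b N p → h ℕ.+ b ℕ.* (N ℕ.* p) ℕ.+ (h ℕ.+ b ℕ.* (N ℕ.* p)) ≡ 2 ℕ.* N ℕ.* b ℕ.* p ℕ.+ 2 ℕ.* h
    id = ℕS.solve-∀

  -- If ∣a∣ is much larger than ∣b∣, the leading term of F dominates; otherwise ∣b∣ is comparable to the height, and
  -- the Bézout identity shows that F and G cannot both be small.
  lowerConstant : ℕ → ℕ → (F A B : ℕ → ℤ) → ℕ → ℕ
  lowerConstant d′ n F A B K = 2 ℕ.* K ℕ.+ (1 ℕ.+ 2 ℕ.* norm d′ F) ℕ.^ (n ℕ.+ suc d′) ℕ.* ((norm n A ℕ.+ norm n B) ℕ.* K)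

  lower : ∀ d′ n (F G A B : ℕ → ℤ) a b w K h → b ≢ 0ℤ → w ≢ 0ℤ → F (suc d′) ≢ 0ℤ →
          hev n A a b * hev (suc d′) F a b + hev n B a b * hev (suc d′) G a b ≡ w * b ^ (n ℕ.+ suc d′) →
          ∣ hev (suc d′) F a b ∣ ≤ K ℕ.* h → ∣ hev (suc d′) G a b ∣ ≤ K ℕ.* h →
          (∣ a ∣ ℕ.⊔ ∣ b ∣) ℕ.^ suc d′ ≤ lowerConstant d′ n F A B K ℕ.* h
  lower d′ n F G A B a b w K h b≢0 w≢0 top≢0 bezout F≤ G≤ = split (∣ a ∣ ℕ.≤? L ℕ.* ∣ b ∣)
    where
    open ℕₚ.≤-Reasoning
    d = suc d′
    τ₀ = ∣ a ∣ ℕ.⊔ ∣ b ∣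
    L = 1 ℕ.+ 2 ℕ.* norm d′ F
    N = (norm n A ℕ.+ norm n B) ℕ.* K
    a≤τ : ∣ a ∣ ≤ τ₀
    a≤τ = ℕₚ.m≤m⊔n ∣ a ∣ ∣ b ∣
    b≤τ : ∣ b ∣ ≤ τ₀
    b≤τ = ℕₚ.m≤n⊔m ∣ a ∣ ∣ b ∣
    id : ∀ x y p K h → x ℕ.* p ℕ.* (K ℕ.* h) ℕ.+ y ℕ.* p ℕ.* (K ℕ.* h) ≡ (x ℕ.+ y) ℕ.* K ℕ.* p ℕ.* h
    id = ℕS.solve-∀
    W≤ : ∣ w * b ^ (n ℕ.+ d) ∣ ≤ N ℕ.* τ₀ ℕ.^ n ℕ.* h
    W≤ = subst₂ _≤_ (cong ∣_∣ bezout) (id (norm n A) (norm n B) (τ₀ ℕ.^ n) K h)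
      (abs-+-≤ (hev n A a b * hev d F a b) (hev n B a b * hev d G a b)
        (abs-*-≤ (hev n A a b) (hev d F a b) (∣hev∣≤ n A a b a≤τ b≤τ) F≤)
        (abs-*-≤ (hev n B a b) (hev d G a b) (∣hev∣≤ n B a b a≤τ b≤τ) G≤))
    ∣b∣^≤ : ∣ b ∣ ℕ.^ (n ℕ.+ d) ≤ ∣ w * b ^ (n ℕ.+ d) ∣
    ∣b∣^≤ = begin
      ∣ b ∣ ℕ.^ (n ℕ.+ d) ≡⟨ sym (abs-^ b (n ℕ.+ d)) ⟩
      ∣ b ^ (n ℕ.+ d) ∣ ≤⟨ ℕₚ.m≤n*m _ ∣ w ∣ {{ℕ.>-nonZero (1≤∣ w≢0 ∣)}} ⟩
      ∣ w ∣ ℕ.* ∣ b ^ (n ℕ.+ d) ∣ ≡⟨ sym (ℤₚ.abs-* w _) ⟩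
      ∣ w * b ^ (n ℕ.+ d) ∣ ∎
    cancel : ∀ p q → q ≡ (p + q) ℤ.- p
    cancel = ℤS.solve-∀
    split : Dec (∣ a ∣ ≤ L ℕ.* ∣ b ∣) → τ₀ ℕ.^ d ≤ (2 ℕ.* K ℕ.+ L ℕ.^ (n ℕ.+ d) ℕ.* N) ℕ.* h
    split (yes a≤Lb) = begin
      τ₀ ℕ.^ d ≤⟨ lower-near {τ₀} {∣ b ∣} {L} {n} {d} {h} {N} (ℕₚ.≤-trans (1≤∣ b≢0 ∣) b≤τ)
          (ℕₚ.⊔-lub a≤Lb (ℕₚ.m≤n*m ∣ b ∣ L)) ∣b∣^≤ W≤ ⟩
      L ℕ.^ (n ℕ.+ d) ℕ.* N ℕ.* h ≤⟨ ℕₚ.*-monoˡ-≤ h (ℕₚ.m≤n+m (L ℕ.^ (n ℕ.+ d) ℕ.* N) (2 ℕ.* K)) ⟩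
      (2 ℕ.* K ℕ.+ L ℕ.^ (n ℕ.+ d) ℕ.* N) ℕ.* h ∎
    split (no a≰Lb) = begin
      τ₀ ℕ.^ d ≡⟨ cong (ℕ._^ d) τ≡a ⟩
      ∣ a ∣ ℕ.^ d ≤⟨ lower-far {∣ a ∣} {∣ b ∣} {norm d′ F} {∣ a ∣ ℕ.^ d′} {K ℕ.* h} Lb≤a aᵈ≤ ⟩
      2 ℕ.* (K ℕ.* h) ≡⟨ sym (ℕₚ.*-assoc 2 K h) ⟩
      2 ℕ.* K ℕ.* h ≤⟨ ℕₚ.*-monoˡ-≤ h (ℕₚ.m≤m+n (2 ℕ.* K) (L ℕ.^ (n ℕ.+ d) ℕ.* N)) ⟩
      (2 ℕ.* K ℕ.+ L ℕ.^ (n ℕ.+ d) ℕ.* N) ℕ.* h ∎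
      where
      Lb≤a = ℕₚ.<⇒≤ (ℕₚ.≰⇒> a≰Lb)
      b≤a : ∣ b ∣ ≤ ∣ a ∣
      b≤a = ℕₚ.≤-trans (ℕₚ.m≤n*m ∣ b ∣ L) Lb≤a
      τ≡a : τ₀ ≡ ∣ a ∣
      τ≡a = ℕₚ.m≥n⇒m⊔n≡m b≤a
      aᵈ≤ : ∣ a ∣ ℕ.^ d ≤ K ℕ.* h ℕ.+ ∣ b ∣ ℕ.* (norm d′ F ℕ.* ∣ a ∣ ℕ.^ d′)
      aᵈ≤ = begin
        ∣ a ∣ ℕ.^ d ≡⟨ sym (abs-^ a d) ⟩
        ∣ a ^ d ∣ ≤⟨ ℕₚ.m≤n*m ∣ a ^ d ∣ ∣ F d ∣ {{ℕ.>-nonZero (1≤∣ top≢0 ∣)}} ⟩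
        ∣ F d ∣ ℕ.* ∣ a ^ d ∣ ≡⟨ sym (ℤₚ.abs-* (F d) (a ^ d)) ⟩
        ∣ F d * a ^ d ∣ ≡⟨ cong ∣_∣ (trans (cancel (b * hev d′ F a b) (F d * a ^ d))
            (cong (ℤ._- b * hev d′ F a b) (sym (hev-top d′ F a b)))) ⟩
        ∣ hev d F a b ℤ.- b * hev d′ F a b ∣
            ≤⟨ abs-minus-≤ (hev d F a b) (b * hev d′ F a b) F≤
            (abs-*-≤ b (hev d′ F a b) ℕₚ.≤-refl (∣hev∣≤ d′ F a b ℕₚ.≤-refl b≤a)) ⟩
        K ℕ.* h ℕ.+ ∣ b ∣ ℕ.* (norm d′ F ℕ.* ∣ a ∣ ℕ.^ d′) ∎

  module Bounds (β : RatFun) (M : Model β) where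
    open Model M

    Fv Gv : ℚ → ℤ
    Fv t = hev d F (↥ t) (↧ t)
    Gv t = hev d G (↥ t) (↧ t)

    coordinates : ∀ t → ∃ λ e → (e * nu (evalRF β t) ≡ Fv t) × (e * de (evalRF β t) ≡ Gv t)
    coordinates t with eval (RatFun.den β) t ≟ 0ℚ
    ... | yes g≡0 = Fv t , ℤₚ.*-identityʳ (Fv t) ,
            trans (ℤₚ.*-zeroʳ (Fv t)) (sym (ι-injective
                (trans (G-eval t) (trans (cong (λ z → ι s ℚ.* ι (↧ t ^ d) ℚ.* z) g≡0) (ℚₚ.*-zeroʳ (ι s ℚ.* ι (↧ t ^ d)))))))
    ... | no g≢0 = reduce y (Fv t) (Gv t)
            (trans (cong (ℚ._* y) (G-eval t))
                (trans (id k g y) (trans (cong (λ z → k ℚ.* z) (÷-*-cancel f g {{ℚ.≢-nonZero g≢0}})) (sym (F-eval t)))))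
          where
          f = eval (RatFun.num β) t
          g = eval (RatFun.den β) t
          k = ι s ℚ.* ι (↧ t ^ d)
          y = (f ÷ g) {{ℚ.≢-nonZero g≢0}}
          id : ∀ k g y → k ℚ.* g ℚ.* y ≡ k ℚ.* (y ℚ.* g)
          id = RS.solve-∀ ℚ-ring

    abstract
      cofactor-bound : ∃ λ K → ∀ t e → e * nu (evalRF β t) ≡ Fv t → e * de (evalRF β t) ≡ Gv t → e ≢ 0ℤ × ∣ e ∣ ≤ K
      cofactor-bound = [ (λ top → conclude top (λ t e e∣F e∣G → let x , y , bez = bézoutℚ t in
                            cofactor {↥ t} {↧ t} {x} {y} {e} (Fv t) (Gv t) (hev n A (↥ t) (↧ t)) (hev n B (↥ t) (↧ t))
                                (s * s) (hev d′ F (↥ t) (↧ t)) (F d) (n ℕ.+ d) d bez (hev-top d′ F (↥ t) (↧ t))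
                                (bezout t) e∣F e∣G))
                       , (λ top → conclude top (λ t e e∣F e∣G → let x , y , bez = bézoutℚ t in
                            cofactor {↥ t} {↧ t} {x} {y} {e} (Gv t) (Fv t) (hev n B (↥ t) (↧ t)) (hev n A (↥ t) (↧ t))
                                (s * s) (hev d′ G (↥ t) (↧ t)) (G d) (n ℕ.+ d) d bez (hev-top d′ G (↥ t) (↧ t))
                                (bezout′ t) e∣G e∣F))
                       ]′ top≢0
        where
        bezout′ : ∀ t → hev n B (↥ t) (↧ t) * Gv t + hev n A (↥ t) (↧ t) * Fv t ≡ s * s * ↧ t ^ (n ℕ.+ d)
        bezout′ t = trans (ℤₚ.+-comm (hev n B (↥ t) (↧ t) * Gv t) _) (bezout t)
        conclude : ∀ {c} → c ≢ 0ℤ → (∀ t e → e ∣ Fv t → e ∣ Gv t → e ∣ s * s * c ^ (n ℕ.+ d)) →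
                   ∃ λ K → ∀ t e → e * nu (evalRF β t) ≡ Fv t → e * de (evalRF β t) ≡ Gv t → e ≢ 0ℤ × ∣ e ∣ ≤ K
        conclude {c} c≢0 div = ∣ w ∣ , λ t e num den →
            let e∣w = div t e (divides (nu (evalRF β t)) (trans (sym num) (ℤₚ.*-comm e _)))
                  (divides (de (evalRF β t)) (trans (sym den) (ℤₚ.*-comm e _)))
            in (λ e≡0 → w≢0 (0∣⇒≡0 (subst (_∣ w) e≡0 e∣w))) , ∣⇒abs-≤ {e} {w} w≢0 e∣w
          where
          w : ℤ
          w = s * s * c ^ (n ℕ.+ d)
          w≢0 : w ≢ 0ℤ
          w≢0 = *-≢0 {s * s} {c ^ (n ℕ.+ d)} (*-≢0 {s} {s} s≢0 s≢0) (^-≢0 {c} (n ℕ.+ d) c≢0)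

    K : ℕ
    K = proj₁ cofactor-bound

    X : ℚ → P1
    X = evalRF β

    upper-bound : ∀ t → Ht (X t) ≤ (norm d F ℕ.+ norm d G) ℕ.* τ t ℕ.^ d
    upper-bound t = let e , num , den = coordinates t ; e≢0 , _ = proj₂ cofactor-bound t e num den in
      subst (_≤ (norm d F ℕ.+ norm d G) ℕ.* τ t ℕ.^ d) (sym (Ht≡ (X t)))
        (ℕₚ.⊔-lub (part e≢0 num (ℕₚ.m≤m+n (norm d F) (norm d G)) (∣hev∣≤ d F (↥ t) (↧ t) a≤τ b≤τ))
                  (part e≢0 den (ℕₚ.m≤n+m (norm d G) (norm d F)) (∣hev∣≤ d G (↥ t) (↧ t) a≤τ b≤τ)))
      where
      a≤τ : ∣ ↥ t ∣ ≤ τ t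
      a≤τ = ℕₚ.m≤m⊔n ∣ ↥ t ∣ (↧ₙ t)
      b≤τ : ∣ ↧ t ∣ ≤ τ t
      b≤τ = ℕₚ.m≤n⊔m ∣ ↥ t ∣ (↧ₙ t)
      part : ∀ {e x y N N′} → e ≢ 0ℤ → e * x ≡ y → N ≤ N′ → ∣ y ∣ ≤ N ℕ.* τ t ℕ.^ d → ∣ x ∣ ≤ N′ ℕ.* τ t ℕ.^ d
      part {e} {x} e≢0 refl N≤N′ y≤ = ℕₚ.≤-trans (ℕₚ.m≤n*m ∣ x ∣ ∣ e ∣ {{ℕ.>-nonZero (1≤∣ e≢0 ∣)}})
        (ℕₚ.≤-trans (ℕₚ.≤-reflexive (sym (ℤₚ.abs-* e x))) (ℕₚ.≤-trans y≤ (ℕₚ.*-monoˡ-≤ (τ t ℕ.^ d) N≤N′)))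

    abstract
      lower-bound : ∃ λ C → ∀ t → τ t ℕ.^ d ≤ C ℕ.* Ht (X t)
      lower-bound = [ (λ top → lowerConstant d′ n F A B K , λ t → lower d′ n F G A B (↥ t) (↧ t) (s * s) K (Ht (X t))
          (↧≢0 t) ss≢0 top (bezout t) (F≤ t) (G≤ t))
                    , (λ top → lowerConstant d′ n G B A K , λ t → lower d′ n G F B A (↥ t) (↧ t) (s * s) K (Ht (X t))
                        (↧≢0 t) ss≢0 top
                         (trans (ℤₚ.+-comm (hev n B (↥ t) (↧ t) * Gv t) (hev n A (↥ t) (↧ t) * Fv t)) (bezout t)) (G≤ t) (F≤ t))
                    ]′ top≢0
        where
        ss≢0 : s * s ≢ 0ℤ
        ss≢0 = *-≢0 {s} {s} s≢0 s≢0
        F≤ : ∀ t → ∣ Fv t ∣ ≤ K ℕ.* Ht (X t)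
        F≤ t = let e , num , den = coordinates t ; _ , e≤K = proj₂ cofactor-bound t e num den in
          subst (λ z → ∣ z ∣ ≤ K ℕ.* Ht (X t)) num
              (abs-*-≤ e (nu (X t)) e≤K (subst (∣ nu (X t) ∣ ≤_) (sym (Ht≡ (X t))) (ℕₚ.m≤m⊔n _ _)))
        G≤ : ∀ t → ∣ Gv t ∣ ≤ K ℕ.* Ht (X t)
        G≤ t = let e , num , den = coordinates t ; _ , e≤K = proj₂ cofactor-bound t e num den in
          subst (λ z → ∣ z ∣ ≤ K ℕ.* Ht (X t)) den
              (abs-*-≤ e (de (X t)) e≤K (subst (∣ de (X t) ∣ ≤_) (sym (Ht≡ (X t))) (ℕₚ.m≤n⊔m ∣ nu (X t) ∣ _)))

    -- When β(t) has denominator 1, the value of G is the cancelled factor itself, which is bounded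
    -- uniformly in t.
    integral⇒∣Gv∣≤K : ∀ t → Integral (X t) → ∣ Gv t ∣ ≤ K
    integral⇒∣Gv∣≤K t int = let e , num , den = coordinates t ; _ , e≤K = proj₂ cofactor-bound t e num den in
        subst (λ z → ∣ z ∣ ≤ K) (trans (sym (trans (cong (e *_) (de≡1 (X t) int)) (ℤₚ.*-identityʳ e))) den) e≤K
      where
      de≡1 : ∀ X → Integral X → de X ≡ 1ℤ
      de≡1 (just x) int = cong +_ int

-- Roots of integer polynomials and level sets of forms

module Roots where
  open import Data.Nat using (_≤_; _<_)
  open Ints
  open Forms
  open Counting
  open import Data.Integer using (_+_; _*_; _^_; _-_)

  ev : List ℤ → ℤ → ℤ
  ev []      x = 0ℤ
  ev (c ∷ p) x = c + x * ev p x

  -- The polynomial (x · p(x) − r · p(r)) / (x − r).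
  quotient : ℤ → List ℤ → List ℤ
  quotient r []      = []
  quotient r (c ∷ p) = ev (c ∷ p) r ∷ quotient r p

  ev-quotient : ∀ r p x → (x - r) * ev (quotient r p) x ≡ x * ev p x - r * ev p r
  ev-quotient r [] x = id x r
    where
    id : ∀ x r → (x - r) * 0ℤ ≡ x * 0ℤ - r * 0ℤ
    id = ℤS.solve-∀
  ev-quotient r (c ∷ p) x = trans (id₁ x r c (ev p r) (ev (quotient r p) x))
      (trans (cong (λ z → (x - r) * (c + r * ev p r) + x * z) (ev-quotient r p x)) (id₂ x r c (ev p x) (ev p r)))
    where
    id₁ : ∀ x r c y q → (x - r) * ((c + r * y) + x * q) ≡ (x - r) * (c + r * y) + x * ((x - r) * q)
    id₁ = ℤS.solve-∀
    id₂ : ∀ x r c w y → (x - r) * (c + r * y) + x * (x * w - r * y) ≡ x * (c + x * w) - r * (c + r * y)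
    id₂ = ℤS.solve-∀

  length-quotient : ∀ r p → length (quotient r p) ≡ length p
  length-quotient r [] = refl
  length-quotient r (c ∷ p) = cong suc (length-quotient r p)

  head-zero : ∀ {c r z} → c + r * z ≡ 0ℤ → z ≡ 0ℤ → c ≡ 0ℤ
  head-zero {c} {r} eq refl = trans (sym (trans (cong (λ z → c + z) (ℤₚ.*-zeroʳ r)) (ℤₚ.+-identityʳ c))) eq

  quotient-zero : ∀ r p → All (_≡ 0ℤ) (quotient r p) → All (_≡ 0ℤ) p × ev p r ≡ 0ℤ
  quotient-zero r [] [] = [] , refl
  quotient-zero r (c ∷ p) (z ∷ zs) with zs′ , evp ← quotient-zero r p zs = head-zero {c} {r} {ev p r} z evp ∷ zs′ , z

  -- Subtracting the values of c + x·p(x) at x and at the root r removes c and leaves (x - r) times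
  -- `quotient r p`, which must vanish at all remaining roots. It is as long as p, so induction
  -- applies, and its vanishing gives back both p = 0 and p(r) = 0.
  many-roots⇒zero : ∀ p L → length p ≤ length L → Unique L → (∀ {x} → x ∈ L → ev p x ≡ 0ℤ) → All (_≡ 0ℤ) p
  many-roots⇒zero [] _ _ _ _ = []
  many-roots⇒zero (c ∷ p) (r ∷ L) (s≤s l≤) uniq@(_ ∷ uniq′) roots =
    let zs , evp = quotient-zero r p
          (many-roots⇒zero (quotient r p) L (subst (_≤ length L) (sym (length-quotient r p)) l≤) uniq′ root)
    in head-zero {c} {r} {ev p r} (roots (here refl)) evp ∷ zs
    where
    id : ∀ c x r w y → x * w - r * y ≡ (c + x * w) - (c + r * y)
    id = ℤS.solve-∀
    root : ∀ {x} → x ∈ L → ev (quotient r p) x ≡ 0ℤ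
    root {x} x∈L = [ (λ x-r≡0 → ⊥-elim (Uniqueₚ.Unique[x∷xs]⇒x∉xs uniq (subst (_∈ L) (ℤₚ.i-j≡0⇒i≡j x r x-r≡0) x∈L))) ,
        (λ q≡0 → q≡0) ]′
      (ℤₚ.i*j≡0⇒i≡0∨j≡0 (x - r) (trans (ev-quotient r p x)
          (trans (id c x r (ev p x) (ev p r)) (cong₂ _-_ (roots (there x∈L)) (roots (here refl))))))

  coefficients : ℕ → (ℕ → ℤ) → ℤ → List ℤ
  coefficients zero    c b = c 0 ∷ []
  coefficients (suc d) c b = c 0 * b ^ suc d ∷ coefficients d (c ∘ suc) b

  length-coefficients : ∀ d c b → length (coefficients d c b) ≡ suc d
  length-coefficients zero    c b = refl
  length-coefficients (suc d) c b = cong suc (length-coefficients d (c ∘ suc) b)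

  ev-coefficients : ∀ d c a b → ev (coefficients d c b) a ≡ hev d c a b
  ev-coefficients zero    c a b = trans (cong (λ z → c 0 + z) (ℤₚ.*-zeroʳ a)) (ℤₚ.+-identityʳ (c 0))
  ev-coefficients (suc d) c a b = cong (λ z → c 0 * b ^ suc d + a * z) (ev-coefficients d (c ∘ suc) a b)

  coefficients-zero : ∀ d c {b} → b ≢ 0ℤ → All (_≡ 0ℤ) (coefficients d c b) → ∀ i → i ≤ d → c i ≡ 0ℤ
  coefficients-zero zero c b≢0 (z ∷ []) zero _ = z
  coefficients-zero (suc d) c {b} b≢0 (z ∷ zs) zero _ =
    [ (λ c≡0 → c≡0) , (λ b^≡0 → ⊥-elim (HeightBounds.^-≢0 {b} (suc d) b≢0 b^≡0)) ]′ (ℤₚ.i*j≡0⇒i≡0∨j≡0 (c 0) z)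
  coefficients-zero (suc d) c b≢0 (z ∷ zs) (suc i) (s≤s i≤d) = coefficients-zero d (c ∘ suc) b≢0 zs i i≤d

  -- For fixed b the level y only changes the constant term, so more than d + 1 solutions would make
  -- every higher coefficient vanish, including c (i + 1).
  level-set-bound : ∀ d c {b y} L i → b ≢ 0ℤ → i ≤ d → c (suc i) ≢ 0ℤ → Unique L →
                    (∀ {x} → x ∈ L → hev (suc d) c x b ≡ y) → length L ≤ suc d
  level-set-bound d c {b} {y} L i b≢0 i≤d c≢0 uniq level = ℕₚ.≮⇒≥ λ d<L →
      c≢0 (coefficients-zero d (c ∘ suc) b≢0
          (All.tail (many-roots⇒zero shifted L
          (subst (_≤ length L) (sym (cong suc (length-coefficients d (c ∘ suc) b))) d<L) uniq root)) i i≤d)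
    where
    shifted : List ℤ
    shifted = (c 0 * b ^ suc d - y) ∷ coefficients d (c ∘ suc) b
    id : ∀ p y z → (p - y) + z ≡ (p + z) - y
    id = ℤS.solve-∀
    root : ∀ {x} → x ∈ L → ev shifted x ≡ 0ℤ
    root {x} x∈L = trans (cong (λ z → (c 0 * b ^ suc d - y) + x * z) (ev-coefficients d (c ∘ suc) x b))
      (trans (id (c 0 * b ^ suc d) y (x * hev d (c ∘ suc) x b)) (trans (cong (_- y) (level x∈L)) (ℤₚ.+-inverseʳ y)))

  hev-constant : ∀ d c a b → (∀ i → i < d → c (suc i) ≡ 0ℤ) → hev d c a b ≡ c 0 * b ^ d
  hev-constant zero c a b _ = sym (ℤₚ.*-identityʳ (c 0))
  hev-constant (suc d) c a b cs≡0 = trans (cong (λ z → c 0 * b ^ suc d + a * z)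
      (trans (hev-constant d (c ∘ suc) a b (λ i i<d → cs≡0 (suc i) (s≤s i<d)))
          (trans (cong (_* b ^ d) (cs≡0 0 (s≤s z≤n))) (ℤₚ.*-zeroˡ (b ^ d)))))
    (trans (cong (λ z → c 0 * b ^ suc d + z) (ℤₚ.*-zeroʳ a)) (ℤₚ.+-identityʳ (c 0 * b ^ suc d)))

  unique-map-on : ∀ {A B : Set} (f : A → B) xs → (∀ {x y} → x ∈ xs → y ∈ xs → f x ≡ f y → x ≡ y) → Unique xs → Unique (map f xs)
  unique-map-on f [] _ _ = []
  unique-map-on f (x ∷ xs) inj (x≢ ∷ uniq) =
    All.tabulate (λ {z} z∈ fx≡z → let y , y∈xs , z≡fy = ∈-map⁻ f z∈ in
        All.lookup x≢ y∈xs (inj (here refl) (there y∈xs) (trans fx≡z z≡fy)))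
      ∷ unique-map-on f xs (λ p q → inj (there p) (there q)) uniq

  ℚ-≡ : ∀ {p q} → ↥ p ≡ ↥ q → ↧ₙ p ≡ ↧ₙ q → p ≡ q
  ℚ-≡ {mkℚ _ _ _} {mkℚ _ _ _} refl refl = refl

  fibers : ∀ {A B : Set} (key : A → B) → (∀ x y → Dec (key x ≡ y)) → ∀ xs ks k → Unique xs → (∀ {x} → x ∈ xs → key x ∈ ks) →
           (∀ y zs → Unique zs → (∀ {x} → x ∈ zs → x ∈ xs × key x ≡ y) → length zs ≤ k) → length xs ≤ length ks ℕ.* k
  fibers key dec xs ks k uniq keys fiber≤ = ℕₚ.≤-trans
    (unique-⊆⇒length-≤ xs (concatMap fiber ks) uniq
        (λ x∈ → ∈-concatMap⁺ fiber (lose (keys x∈) (∈-filter⁺ (λ x → dec x _) x∈ refl))))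
    (length-concatMap-≤ fiber k ks (λ y _ → fiber≤ y (fiber y) (Uniqueₚ.filter⁺ (λ x → dec x y) uniq)
        (∈-filter⁻ (λ x → dec x y))))
    where
    fiber = λ y → filter (λ x → dec x y) xs

-- Few parameters with integral β(t), many parameters in all

module Families where
  open import Data.Nat using (_≤_; _<_)
  open Ints
  open Forms
  open Dynamics
  open Counting
  open Heights
  open HeightBounds
  open Roots

  module _ (β : RatFun) (M : Model β) where
    open Model M
    open Bounds β M

    integralConstant : ℕ
    integralConstant = suc (K ℕ.+ K) ℕ.* d ℕ.+ K

    -- If G involves a, each denominator up to T and each value in [-K, K] admits at most d
    -- numerators. Otherwise G is a nonzero multiple of b^d, which bounds the denominator by K and
    -- leaves the numerator free. Both counts are linear in T.
    integral-count : ∀ T L → Unique L → (∀ {t} → t ∈ L → τ t ≤ T × ∣ Gv t ∣ ≤ K) → length L ≤ suc (T ℕ.+ T) ℕ.* integralConstant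
    integral-count T L uniq bounds with ℕₚ.anyUpTo? (λ i → ¬? (G (suc i) ℤ.≟ 0ℤ)) d
    ... | yes (i , i<d , Gi≢0) = ℕₚ.≤-trans (fibers ↧ₙ_ (λ t q → ↧ₙ t ℕ.≟ q) L (map suc (upTo T)) _ uniq den∈ inner) (begin
        length (map suc (upTo T)) ℕ.* (suc (K ℕ.+ K) ℕ.* d)
            ≡⟨ cong (ℕ._* (suc (K ℕ.+ K) ℕ.* d)) (trans (length-map suc (upTo T)) (length-upTo T)) ⟩
        T ℕ.* (suc (K ℕ.+ K) ℕ.* d) ≤⟨ ℕₚ.*-mono-≤ (ℕₚ.≤-trans (ℕₚ.m≤m+n T T) (ℕₚ.n≤1+n (T ℕ.+ T)))
            (ℕₚ.m≤m+n (suc (K ℕ.+ K) ℕ.* d) K) ⟩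
        suc (T ℕ.+ T) ℕ.* integralConstant ∎)
      where
      open ℕₚ.≤-Reasoning
      ∈-suc : ∀ t → ↧ₙ t ≤ T → ↧ₙ t ∈ map suc (upTo T)
      ∈-suc t@record{} d≤T = ∈-map⁺ suc (∈-upTo⁺ d≤T)
      den∈ : ∀ {t} → t ∈ L → ↧ₙ t ∈ map suc (upTo T)
      den∈ {t} t∈L = ∈-suc t (ℕₚ.m⊔n≤o⇒n≤o ∣ ↥ t ∣ _ (proj₁ (bounds t∈L)))
      inner : ∀ q zs → Unique zs → (∀ {t} → t ∈ zs → t ∈ L × ↧ₙ t ≡ q) → length zs ≤ suc (K ℕ.+ K) ℕ.* d
      inner q zs uniq′ in-fiber = subst (λ k → length zs ≤ k ℕ.* d) (length-intsUpTo K)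
          (fibers Gv (λ t y → Gv t ℤ.≟ y) zs (intsUpTo K) d uniq′
              (λ {t} t∈ → ∈-intsUpTo (Gv t) (proj₂ (bounds (proj₁ (in-fiber t∈))))) innermost)
        where
        innermost : ∀ y ws → Unique ws → (∀ {t} → t ∈ ws → t ∈ zs × Gv t ≡ y) → length ws ≤ d
        innermost y [] _ _ = z≤n
        innermost y ws@(t₀ ∷ _) uniq″ in-fiber′ = subst (_≤ d) (length-map ↥_ ws)
            (level-set-bound d′ G {↧ t₀} {y} (map ↥_ ws) i (↧≢0 t₀) (ℕ.s≤s⁻¹ i<d) Gi≢0
              (unique-map-on ↥_ ws (λ p q eq → ℚ-≡ eq (trans (den≡q p) (sym (den≡q q)))) uniq″) level)
          where
          den≡q : ∀ {t} → t ∈ ws → ↧ₙ t ≡ q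
          den≡q t∈ = proj₂ (in-fiber (proj₁ (in-fiber′ t∈)))
          level : ∀ {a} → a ∈ map ↥_ ws → hev d G a (↧ t₀) ≡ y
          level a∈ with t , t∈ , refl ← ∈-map⁻ ↥_ a∈ =
            trans (cong (λ k → hev d G (↥ t) (+ k)) (trans (den≡q (here refl)) (sym (den≡q t∈)))) (proj₂ (in-fiber′ t∈))
    ... | no none = begin
        length L ≤⟨ unique-⊆⇒length-≤ L (rationals T K) uniq
            (λ {t} t∈L → ∈-rationals t (ℕₚ.m⊔n≤o⇒m≤o ∣ ↥ t ∣ _ (proj₁ (bounds t∈L))) (den≤K t (proj₂ (bounds t∈L)))) ⟩
        length (rationals T K) ≡⟨ length-rationals T K ⟩
        suc (T ℕ.+ T) ℕ.* K ≤⟨ ℕₚ.*-monoʳ-≤ (suc (T ℕ.+ T)) (ℕₚ.m≤n+m K (suc (K ℕ.+ K) ℕ.* d)) ⟩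
        suc (T ℕ.+ T) ℕ.* integralConstant ∎
      where
      open ℕₚ.≤-Reasoning
      vanish : ∀ i → i < d → G (suc i) ≡ 0ℤ
      vanish i i<d = decidable-stable (G (suc i) ℤ.≟ 0ℤ) (λ Gi≢0 → none (i , i<d , Gi≢0))
      G0≢0 : G 0 ≢ 0ℤ
      G0≢0 with G≢0
      ... | zero , _ , G₀≢0 = G₀≢0
      ... | suc i , i<d , Gi≢0 = ⊥-elim (Gi≢0 (vanish i i<d))
      den≤K : ∀ t → ∣ Gv t ∣ ≤ K → ↧ₙ t ≤ K
      den≤K t G≤K = begin
        ↧ₙ t ≤⟨ ℕₚ.m≤m*n (↧ₙ t) (↧ₙ t ℕ.^ d′) {{ℕₚ.m^n≢0 (↧ₙ t) d′ {{den-nonZero}}}} ⟩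
        ∣ ↧ t ∣ ℕ.^ d ≡⟨ sym (abs-^ (↧ t) d) ⟩
        ∣ ↧ t ℤ.^ d ∣ ≤⟨ ℕₚ.m≤n*m ∣ ↧ t ℤ.^ d ∣ ∣ G 0 ∣ {{ℕ.>-nonZero (1≤∣ G0≢0 ∣)}} ⟩
        ∣ G 0 ∣ ℕ.* ∣ ↧ t ℤ.^ d ∣ ≡⟨ sym (ℤₚ.abs-* (G 0) (↧ t ℤ.^ d)) ⟩
        ∣ G 0 ℤ.* ↧ t ℤ.^ d ∣ ≡⟨ cong ∣_∣ (sym (hev-constant d G (↥ t) (↧ t) vanish)) ⟩
        ∣ Gv t ∣ ≤⟨ G≤K ⟩
        K ∎
        where
        den-nonZero : ℕ.NonZero (↧ₙ t)
        den-nonZero = ℕ.>-nonZero (1≤∣ ↧≢0 t ∣)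

  coprime-odd-2 : ∀ i → Coprimeℕ (1 ℕ.+ 2 ℕ.* i) 2
  coprime-odd-2 i {k} (k∣odd , k∣2) = ∣ℕ.∣1⇒≡1 (∣ℕ.∣m+n∣m⇒∣n (subst (k ∣ℕ.∣_) (ℕₚ.+-comm 1 (2 ℕ.* i)) k∣odd) (∣ℕ.∣m⇒∣m*n i k∣2))

  coprime-2^ : ∀ {m} → Coprimeℕ m 2 → ∀ j → Coprimeℕ m (2 ℕ.^ j)
  coprime-2^ m⊥2 zero (_ , k∣1) = ∣ℕ.∣1⇒≡1 k∣1
  coprime-2^ m⊥2 (suc j) (k∣m , k∣2^) = coprime-2^ m⊥2 j (k∣m ,
    Coprimality.coprime-divisor (λ (l∣k , l∣2) → m⊥2 (∣ℕ.∣-trans l∣k k∣m , l∣2)) k∣2^)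

  suc-pred-2^ : ∀ j → suc (ℕ.pred (2 ℕ.^ j)) ≡ 2 ℕ.^ j
  suc-pred-2^ j = ℕₚ.suc-pred (2 ℕ.^ j) {{ℕₚ.m^n≢0 2 j}}

  dyadic : ℕ → ℕ → ℚ
  dyadic j i = mkℚ (+ (1 ℕ.+ 2 ℕ.* i)) (ℕ.pred (2 ℕ.^ j))
      (subst (Coprimeℕ (1 ℕ.+ 2 ℕ.* i)) (sym (suc-pred-2^ j)) (coprime-2^ (coprime-odd-2 i) j))

  2^-injective : ∀ j k → 2 ℕ.^ j ≡ 2 ℕ.^ k → j ≡ k
  2^-injective j k eq = ℕₚ.≤-antisym (ℕₚ.≮⇒≥ (λ k<j → ℕₚ.<-irrefl (sym eq) (ℕₚ.^-monoʳ-< 2 (s≤s (s≤s z≤n)) k<j)))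
    (ℕₚ.≮⇒≥ (λ j<k → ℕₚ.<-irrefl eq (ℕₚ.^-monoʳ-< 2 (s≤s (s≤s z≤n)) j<k)))

  dyadic-injective : ∀ {j k i l} → dyadic j i ≡ dyadic k l → j ≡ k × i ≡ l
  dyadic-injective {j} {k} {i} {l} eq =
    2^-injective j k (trans (sym (suc-pred-2^ j)) (trans (cong ↧ₙ_ eq) (suc-pred-2^ k))) ,
    ℕₚ.*-cancelˡ-≡ i l 2 (ℕₚ.suc-injective (ℤₚ.+-injective (cong ↥_ eq)))

  dyadic≢-1 : ∀ j i → dyadic j i ≢ m1
  dyadic≢-1 j i eq with () ← cong ↥_ eq

  dyadic-height : ∀ {J S j i} → 2 ℕ.^ J ≤ S → j < J → i < S → τ (dyadic j i) ≤ 2 ℕ.* S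
  dyadic-height {J} {S} {j} {i} 2^J≤S j<J i<S = ℕₚ.⊔-lub
    (ℕₚ.≤-trans (ℕₚ.n≤1+n _) (ℕₚ.≤-trans (ℕₚ.≤-reflexive (sym (ℕₚ.*-suc 2 i))) (ℕₚ.*-monoʳ-≤ 2 i<S)))
    (ℕₚ.≤-trans (ℕₚ.≤-reflexive (suc-pred-2^ j)) (ℕₚ.≤-trans (ℕₚ.^-monoʳ-≤ 2 (ℕₚ.<⇒≤ j<J)) (ℕₚ.≤-trans 2^J≤S (ℕₚ.m≤n*m S 2))))

  -- J exponents and S odd numerators give distinct fractions, and 2^J ≤ S keeps the numerators
  -- decisive for the height bound 2S. J may be any constant once S is large.
  dyadic-count : ∀ J S Ts → 2 ℕ.^ J ≤ S → (∀ t → t ≢ m1 → τ t ≤ 2 ℕ.* S → t ∈ Ts) → J ℕ.* S ≤ length Ts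
  dyadic-count J S Ts 2^J≤S contains = subst (_≤ length Ts)
    (trans (length-cartesianProductWith dyadic (upTo J) (upTo S)) (cong₂ ℕ._*_ (length-upTo J) (length-upTo S)))
    (unique-⊆⇒length-≤ (cartesianProductWith dyadic (upTo J) (upTo S)) Ts
      (Uniqueₚ.cartesianProductWith⁺ dyadic dyadic-injective (Uniqueₚ.upTo⁺ J) (Uniqueₚ.upTo⁺ S))
      (λ t∈ → let j , i , j∈ , i∈ , t≡ = ∈-cartesianProductWith⁻ dyadic (upTo J) (upTo S) t∈ in
        subst (_∈ Ts) (sym t≡) (contains (dyadic j i) (dyadic≢-1 j i) (dyadic-height {J} {S} 2^J≤S (∈-upTo⁻ j∈) (∈-upTo⁻ i∈)))))

-- Assembling the average

module Average where
  open import Data.Nat using (_≤_; _<_)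
  open import Data.Rational.Properties using (_≟_)
  open import Data.List.Relation.Unary.Unique.DecPropositional.Properties ℚₚ._≟_ using (deduplicate-!)
  open Dynamics
  open Counting
  open Heights
  open HeightBounds
  open Families
  open Rationals using (ι; /1≡ι)

  -- A positive rational with denominator q is at least 1/q, so the comparison reduces to natural
  -- numbers.
  <-ε* : ∀ ε m n → 0ℚ ℚ.< ε → ↧ₙ ε ℕ.* m < n → ℕtoℚ m ℚ.< ε ℚ.* ℕtoℚ n
  <-ε* ε@(mkℚ z q-1 c) m n 0<ε qm<n = subst₂ (λ x y → x ℚ.< ε ℚ.* y) (sym (/1≡ι (+ m))) (sym (/1≡ι (+ n)))
      (ℚₚ.toℚᵘ-cancel-< (ℚᵘₚ.<-respʳ-≃ (ℚᵘₚ.≃-sym (ℚₚ.toℚᵘ-homo-* ε (ι (+ n)))) (*<* (lemma z (ℚ.positive 0<ε)))))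
    where
    open ℕₚ.≤-Reasoning
    id : ∀ m q → m ℕ.* (q ℕ.* 1) ≡ q ℕ.* m
    id = ℕS.solve-∀
    lemma : ∀ z → ℤ.Positive z → (+ m) ℤ.* ((+ suc q-1) ℤ.* 1ℤ) ℤ.< z ℤ.* (+ n) ℤ.* 1ℤ
    lemma (+ suc p) _ = subst₂ ℤ._<_
      (trans (ℤₚ.pos-* m (suc q-1 ℕ.* 1)) (cong ((+ m) ℤ.*_) (ℤₚ.pos-* (suc q-1) 1)))
      (trans (ℤₚ.pos-* (suc p) n) (sym (ℤₚ.*-identityʳ _)))
      (ℤ.+<+ (begin-strict
        m ℕ.* (suc q-1 ℕ.* 1) ≡⟨ id m (suc q-1) ⟩
        suc q-1 ℕ.* m <⟨ qm<n ⟩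
        n ≤⟨ ℕₚ.m≤n*m n (suc p) ⟩
        suc p ℕ.* n ∎))

  root : ∀ C d′ → 1 ≤ C → ∀ N → ∃ λ S → C ℕ.* S ℕ.^ suc d′ ≤ N × N < C ℕ.* suc S ℕ.^ suc d′
  root C d′ 1≤C zero = 0 , ℕₚ.≤-reflexive (ℕₚ.*-zeroʳ C) , ℕₚ.*-mono-≤ 1≤C (ℕₚ.m^n>0 1 (suc d′))
  root C d′ 1≤C (suc N) with root C d′ 1≤C N
  ... | S , lo , hi with C ℕ.* suc S ℕ.^ suc d′ ℕ.≤? suc N
  ... | yes le = suc S , le , ℕₚ.≤-<-trans hi (ℕₚ.*-monoʳ-< C {{ℕ.>-nonZero 1≤C}} (ℕₚ.^-monoˡ-< (suc d′) (ℕₚ.n<1+n (suc S))))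
  ... | no ¬le = S , ℕₚ.m≤n⇒m≤1+n lo , ℕₚ.≰⇒> ¬le

  ^-cancel-≤ : ∀ {m n} d′ → m ℕ.^ suc d′ ≤ n ℕ.^ suc d′ → m ≤ n
  ^-cancel-≤ d′ le = ℕₚ.≮⇒≥ (λ n<m → ℕₚ.<⇒≱ (ℕₚ.^-monoˡ-< (suc d′) n<m) le)

  module _ (β : RatFun) (M : Model β) where
    open Model M
    open Bounds β M
    open Forms using (norm)

    -- `c₁` is the upper height constant adjusted to parameters of height 2S, the range of the
    -- dyadic family; `c₂` is the lower one; the added 1 makes both positive. `T₀` is what
    -- `large⇒Big` requires, and `W₀` bounds all orbit counts below it at once.
    c₁ c₂ T₀ W₀ : ℕ
    c₁ = suc (norm d F ℕ.+ norm d G) ℕ.* 2 ℕ.^ d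
    c₂ = suc (proj₁ lower-bound)
    T₀ = 128 ℕ.* (c₂ ℕ.* c₂)
    W₀ = 2 ℕ.+ length (points (threshold T₀))

    1≤c₁ : 1 ≤ c₁
    1≤c₁ = ℕₚ.*-mono-≤ {1} {suc (norm d F ℕ.+ norm d G)} (s≤s z≤n) (ℕₚ.m^n>0 2 d)

    τ^d≤ : ∀ t → τ t ℕ.^ d ≤ c₂ ℕ.* Ht (X t)
    τ^d≤ t = ℕₚ.≤-trans (proj₂ lower-bound t) (ℕₚ.m≤n+m _ (Ht (X t)))

    -- From τ³ ≤ τ^d ≤ c₂·H follows τ⁶ ≤ c₂²·H². Of the two surplus powers over τ⁴ one absorbs the
    -- factor 128·c₂² and the other is dropped.
    large⇒Big : ∀ t → T₀ ≤ τ t → Big t (X t)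
    large⇒Big t T₀≤τ = subst (_≤ Ht (X t) ℕ.* Ht (X t)) (sym (threshold≡ (τ t))) (scaled (τ t) (Ht (X t)) c₂ T₀≤τ (1≤τ t)
        (ℕₚ.≤-trans (ℕₚ.^-monoʳ-≤ (τ t) {{ℕ.>-nonZero (1≤τ t)}} 3≤d) (τ^d≤ t)))
      where
      open ℕₚ.≤-Reasoning
      id₁ : ∀ c τ → c ℕ.* (128 ℕ.* τ) ≡ 128 ℕ.* c ℕ.* τ
      id₁ = ℕS.solve-∀
      id₂ : ∀ τ → τ ℕ.* (τ ℕ.* τ ℕ.* τ ℕ.* τ) ℕ.* τ ≡ (τ ℕ.* (τ ℕ.* (τ ℕ.* 1))) ℕ.* (τ ℕ.* (τ ℕ.* (τ ℕ.* 1)))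
      id₂ = ℕS.solve-∀
      id₃ : ∀ c h → c ℕ.* h ℕ.* (c ℕ.* h) ≡ c ℕ.* c ℕ.* (h ℕ.* h)
      id₃ = ℕS.solve-∀
      scaled : ∀ τ h c .{{_ : ℕ.NonZero c}} → 128 ℕ.* (c ℕ.* c) ≤ τ → 1 ≤ τ → τ ℕ.* (τ ℕ.* (τ ℕ.* 1)) ≤ c ℕ.* h →
          128 ℕ.* (τ ℕ.* τ ℕ.* τ ℕ.* τ) ≤ h ℕ.* h
      scaled τ h c 128cc≤τ 1≤τ τ³≤ = ℕₚ.*-cancelˡ-≤ (c ℕ.* c) {{ℕₚ.m*n≢0 c c}} (begin
        c ℕ.* c ℕ.* (128 ℕ.* (τ ℕ.* τ ℕ.* τ ℕ.* τ)) ≡⟨ id₁ (c ℕ.* c) (τ ℕ.* τ ℕ.* τ ℕ.* τ) ⟩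
        128 ℕ.* (c ℕ.* c) ℕ.* (τ ℕ.* τ ℕ.* τ ℕ.* τ) ≤⟨ ℕₚ.*-monoˡ-≤ _ 128cc≤τ ⟩
        τ ℕ.* (τ ℕ.* τ ℕ.* τ ℕ.* τ) ≤⟨ ℕₚ.m≤m*n _ τ {{ℕ.>-nonZero 1≤τ}} ⟩
        τ ℕ.* (τ ℕ.* τ ℕ.* τ ℕ.* τ) ℕ.* τ ≡⟨ id₂ τ ⟩
        (τ ℕ.* (τ ℕ.* (τ ℕ.* 1))) ℕ.* (τ ℕ.* (τ ℕ.* (τ ℕ.* 1))) ≤⟨ ℕₚ.*-mono-≤ τ³≤ τ³≤ ⟩
        c ℕ.* h ℕ.* (c ℕ.* h) ≡⟨ id₃ c h ⟩
        c ℕ.* c ℕ.* (h ℕ.* h) ∎)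

    threshold-mono : ∀ {m n} → m ≤ n → threshold m ≤ threshold n
    threshold-mono {m} {n} m≤n = subst₂ _≤_ (sym (threshold≡ m)) (sym (threshold≡ n))
      (ℕₚ.*-monoʳ-≤ 128 (ℕₚ.*-mono-≤ (ℕₚ.*-mono-≤ (ℕₚ.*-mono-≤ m≤n m≤n) m≤n) m≤n))

    small? : ∀ t → Dec (τ t < T₀)
    small? t = τ t ℕ.<? T₀

    intβ? : ∀ t → Dec (Integral (X t))
    intβ? t = integral? (X t)

    Counted : ℚ → ℕ → Set
    Counted t = IntOrbitCount t (X t)

    small-count : ∀ t → t ≢ m1 → τ t < T₀ → ∃ λ c → Counted t c × c ≤ W₀
    small-count t t≢-1 τ<T₀ = Orbit.orbit-count t (X t) t≢-1 (threshold T₀) (threshold-mono (ℕₚ.<⇒≤ τ<T₀))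

    large-count : ∀ t → t ≢ m1 → ¬ τ t < T₀ → ∃ λ c → Counted t c × c ≤ 1 × (¬ Integral (X t) → c ≡ 0)
    -- The pigeonhole argument serves here only for the existence of the count; its bound depends on
    -- t and is replaced by the one from growth.
    large-count t t≢-1 τ≮T₀ = let c , counted , _ = Orbit.orbit-count t (X t) t≢-1 (threshold (τ t)) ℕₚ.≤-refl in
      c , counted , Orbit.Big⇒count-≤1 t (X t) t≢-1 big counted , λ ¬int → Orbit.Big⇒count≡0 t (X t) t≢-1 big ¬int counted
      where
      big = large⇒Big t (ℕₚ.≮⇒≥ τ≮T₀)

    count : ∀ {P : ℚ → Set} → (∀ t → Dec (P t)) → List ℚ → ℕ
    count P? Ts = length (filter P? Ts)

    count-yes : ∀ {P : ℚ → Set} (P? : ∀ t → Dec (P t)) t Ts → P t → count P? (t ∷ Ts) ≡ suc (count P? Ts)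
    count-yes P? t Ts Pt = cong length (filter-accept P? Pt)

    count-mono : ∀ {P : ℚ → Set} (P? : ∀ t → Dec (P t)) t Ts → count P? Ts ≤ count P? (t ∷ Ts)
    count-mono P? t Ts with P? t
    ... | yes _ = ℕₚ.n≤1+n _
    ... | no  _ = ℕₚ.≤-refl

    orbit-counts : ∀ Ts → (∀ {t} → t ∈ Ts → t ≢ m1) → ∃ λ cs →
        Pointwise Counted Ts cs × sum cs ≤ count small? Ts ℕ.* W₀ ℕ.+ count intβ? Ts
    orbit-counts [] _ = [] , [] , z≤n
    orbit-counts (t ∷ Ts) ≢-1 = extend (orbit-counts Ts (≢-1 ∘ there)) (small? t) (intβ? t)
      where
      open ℕₚ.≤-Reasoning
      id : ∀ w s i → w ℕ.+ (s ℕ.* w ℕ.+ i) ≡ suc s ℕ.* w ℕ.+ i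
      id = ℕS.solve-∀
      id′ : ∀ s i → 1 ℕ.+ (s ℕ.+ i) ≡ s ℕ.+ suc i
      id′ = ℕS.solve-∀
      Bound : List ℚ → ℕ
      Bound Ts = count small? Ts ℕ.* W₀ ℕ.+ count intβ? Ts
      extend : (∃ λ cs → Pointwise Counted Ts cs × sum cs ≤ Bound Ts) → Dec (τ t < T₀) → Dec (Integral (X t)) →
               ∃ λ cs → Pointwise Counted (t ∷ Ts) cs × sum cs ≤ Bound (t ∷ Ts)
      extend (cs , pw , sum≤) (yes small) _ = let c , counted , c≤ = small-count t (≢-1 (here refl)) small in
          c ∷ cs , counted ∷ pw , (begin
        c ℕ.+ sum cs ≤⟨ ℕₚ.+-mono-≤ c≤ sum≤ ⟩
        W₀ ℕ.+ (count small? Ts ℕ.* W₀ ℕ.+ count intβ? Ts) ≡⟨ id W₀ (count small? Ts) (count intβ? Ts) ⟩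
        suc (count small? Ts) ℕ.* W₀ ℕ.+ count intβ? Ts
            ≡⟨ cong (λ k → k ℕ.* W₀ ℕ.+ count intβ? Ts) (sym (count-yes small? t Ts small)) ⟩
        count small? (t ∷ Ts) ℕ.* W₀ ℕ.+ count intβ? Ts ≤⟨ ℕₚ.+-monoʳ-≤ _ (count-mono intβ? t Ts) ⟩
        Bound (t ∷ Ts) ∎)
      extend (cs , pw , sum≤) (no ¬small) (yes int) =
          let c , counted , c≤1 , _ = large-count t (≢-1 (here refl)) ¬small in c ∷ cs , counted ∷ pw , (begin
        c ℕ.+ sum cs ≤⟨ ℕₚ.+-mono-≤ c≤1 sum≤ ⟩
        1 ℕ.+ (count small? Ts ℕ.* W₀ ℕ.+ count intβ? Ts) ≡⟨ id′ (count small? Ts ℕ.* W₀) (count intβ? Ts) ⟩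
        count small? Ts ℕ.* W₀ ℕ.+ suc (count intβ? Ts)
            ≤⟨ ℕₚ.+-mono-≤ (ℕₚ.*-monoˡ-≤ W₀ (count-mono small? t Ts)) (ℕₚ.≤-reflexive (sym (count-yes intβ? t Ts int))) ⟩
        Bound (t ∷ Ts) ∎)
      extend (cs , pw , sum≤) (no ¬small) (no ¬int) =
          let c , counted , _ , c≡0 = large-count t (≢-1 (here refl)) ¬small in c ∷ cs , counted ∷ pw , (begin
        c ℕ.+ sum cs ≡⟨ cong (ℕ._+ sum cs) (c≡0 ¬int) ⟩
        sum cs ≤⟨ sum≤ ⟩
        Bound Ts ≤⟨ ℕₚ.+-mono-≤ (ℕₚ.*-monoˡ-≤ W₀ (count-mono small? t Ts)) (count-mono intβ? t Ts) ⟩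
        Bound (t ∷ Ts) ∎)

    n₀ Q : ℕ
    n₀ = suc (T₀ ℕ.+ T₀) ℕ.* T₀
    Q = n₀ ℕ.* W₀ ℕ.+ (1 ℕ.+ 4 ℕ.* (c₂ ℕ.* c₁)) ℕ.* integralConstant β M

    module _ (N S : ℕ) (1≤S : 1 ≤ S) (lo : c₁ ℕ.* S ℕ.^ d ≤ N) (hi : N < c₁ ℕ.* suc S ℕ.^ d) where
      open ℕₚ.≤-Reasoning

      T : ℕ
      T = c₂ ℕ.* c₁ ℕ.* suc S

      -- The constant is moved inside the d-th power by c ≤ c^d, so that a d-th root can be taken in
      -- the natural numbers.
      τ≤T : ∀ t → Ht (X t) ≤ N → τ t ≤ T
      τ≤T t h≤N = ^-cancel-≤ d′ (begin
        τ t ℕ.^ d ≤⟨ τ^d≤ t ⟩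
        c₂ ℕ.* Ht (X t) ≤⟨ ℕₚ.*-monoʳ-≤ c₂ (ℕₚ.≤-trans h≤N (ℕₚ.<⇒≤ hi)) ⟩
        c₂ ℕ.* (c₁ ℕ.* suc S ℕ.^ d) ≡⟨ sym (ℕₚ.*-assoc c₂ c₁ _) ⟩
        c₂ ℕ.* c₁ ℕ.* suc S ℕ.^ d ≤⟨ ℕₚ.*-monoˡ-≤ (suc S ℕ.^ d)
            (ℕₚ.m≤m*n (c₂ ℕ.* c₁) ((c₂ ℕ.* c₁) ℕ.^ d′)
            {{ℕₚ.m^n≢0 (c₂ ℕ.* c₁) d′ {{ℕ.>-nonZero (ℕₚ.*-mono-≤ {1} {c₂} (s≤s z≤n) 1≤c₁)}}}}) ⟩
        (c₂ ℕ.* c₁) ℕ.^ d ℕ.* suc S ℕ.^ d ≡⟨ sym (^-distribʳ-* (c₂ ℕ.* c₁) (suc S) d) ⟩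
        T ℕ.^ d ∎)

      low-height : ∀ t → τ t ≤ 2 ℕ.* S → Ht (X t) ≤ N
      low-height t τ≤2S = begin
        Ht (X t) ≤⟨ upper-bound t ⟩
        (norm d F ℕ.+ norm d G) ℕ.* τ t ℕ.^ d ≤⟨ ℕₚ.*-mono-≤ (ℕₚ.n≤1+n (norm d F ℕ.+ norm d G)) (ℕₚ.^-monoˡ-≤ d τ≤2S) ⟩
        suc (norm d F ℕ.+ norm d G) ℕ.* (2 ℕ.* S) ℕ.^ d ≡⟨ cong (suc (norm d F ℕ.+ norm d G) ℕ.*_) (^-distribʳ-* 2 S d) ⟩
        suc (norm d F ℕ.+ norm d G) ℕ.* (2 ℕ.^ d ℕ.* S ℕ.^ d)
            ≡⟨ sym (ℕₚ.*-assoc (suc (norm d F ℕ.+ norm d G)) (2 ℕ.^ d) (S ℕ.^ d)) ⟩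
        c₁ ℕ.* S ℕ.^ d ≤⟨ lo ⟩
        N ∎

      param? : ∀ t → Dec (t ≢ m1 × Ht (X t) ≤ N)
      param? t = ¬? (t ≟ m1) ×-dec (Ht (X t) ℕ.≤? N)

      Ts : List ℚ
      Ts = filter param? (deduplicate _≟_ (rationals T T))

      Ts-unique : Unique Ts
      Ts-unique = Uniqueₚ.filter⁺ param? (deduplicate-! (rationals T T))

      ∈-Ts⁻ : ∀ {t} → t ∈ Ts → t ≢ m1 × Ht (X t) ≤ N
      ∈-Ts⁻ t∈ = proj₂ (∈-filter⁻ param? {xs = deduplicate _≟_ (rationals T T)} t∈)

      ∈-Ts⁺ : ∀ {t} → t ≢ m1 × Ht (X t) ≤ N → t ∈ Ts
      ∈-Ts⁺ {t} ok = ∈-filter⁺ param? (∈-deduplicate⁺ _≟_ (∈-rationals-Ht t (τ≤T t (proj₂ ok)))) ok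

      enumerates : EnumParams β N Ts
      enumerates = Ts-unique , λ t → mk⇔ ∈-Ts⁻ ∈-Ts⁺

      many : ∀ J → 2 ℕ.^ J ≤ S → J ℕ.* S ≤ length Ts
      many J 2^J≤S = dyadic-count J S Ts 2^J≤S (λ t t≢-1 τ≤ → ∈-Ts⁺ (t≢-1 , low-height t τ≤))

      few-small : count small? Ts ≤ n₀
      few-small = ℕₚ.≤-trans (unique-⊆⇒length-≤ (filter small? Ts) (rationals T₀ T₀) (Uniqueₚ.filter⁺ small? Ts-unique)
          (λ {t} t∈ → ∈-rationals-Ht t (ℕₚ.<⇒≤ (proj₂ (∈-filter⁻ small? {xs = Ts} t∈)))))
        (ℕₚ.≤-reflexive (length-rationals T₀ T₀))

      few-integral : count intβ? Ts ≤ suc (T ℕ.+ T) ℕ.* integralConstant β M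
      few-integral = integral-count β M T (filter intβ? Ts) (Uniqueₚ.filter⁺ intβ? Ts-unique)
        (λ {t} t∈ → let t∈Ts , int = ∈-filter⁻ intβ? {xs = Ts} t∈ in τ≤T t (proj₂ (∈-Ts⁻ t∈Ts)) , integral⇒∣Gv∣≤K t int)

      -- Here 1 ≤ S absorbs both the isolated 1 and the step from S to S + 1, making the bound a
      -- pure multiple of S.
      suc[T+T]≤ : suc (T ℕ.+ T) ≤ (1 ℕ.+ 4 ℕ.* (c₂ ℕ.* c₁)) ℕ.* S
      suc[T+T]≤ = ℕₚ.+-mono-≤ 1≤S (begin
          T ℕ.+ T ≡⟨ id (c₂ ℕ.* c₁) (suc S) ⟩
          2 ℕ.* (c₂ ℕ.* c₁) ℕ.* suc S ≤⟨ ℕₚ.*-monoʳ-≤ (2 ℕ.* (c₂ ℕ.* c₁)) (ℕₚ.+-monoˡ-≤ S 1≤S) ⟩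
          2 ℕ.* (c₂ ℕ.* c₁) ℕ.* (S ℕ.+ S) ≡⟨ id′ (c₂ ℕ.* c₁) S ⟩
          4 ℕ.* (c₂ ℕ.* c₁) ℕ.* S ∎)
        where
        id : ∀ c S → c ℕ.* S ℕ.+ c ℕ.* S ≡ 2 ℕ.* c ℕ.* S
        id = ℕS.solve-∀
        id′ : ∀ c S → 2 ℕ.* c ℕ.* (S ℕ.+ S) ≡ 4 ℕ.* c ℕ.* S
        id′ = ℕS.solve-∀

      total≤ : count small? Ts ℕ.* W₀ ℕ.+ count intβ? Ts ≤ Q ℕ.* S
      total≤ = begin
          count small? Ts ℕ.* W₀ ℕ.+ count intβ? Ts
            ≤⟨ ℕₚ.+-mono-≤ (ℕₚ.*-monoˡ-≤ W₀ few-small) (ℕₚ.≤-trans few-integral (ℕₚ.*-monoˡ-≤ (integralConstant β M) suc[T+T]≤)) ⟩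
          n₀ ℕ.* W₀ ℕ.+ (1 ℕ.+ 4 ℕ.* (c₂ ℕ.* c₁)) ℕ.* S ℕ.* integralConstant β M
            ≤⟨ ℕₚ.+-monoˡ-≤ _ (ℕₚ.m≤m*n (n₀ ℕ.* W₀) S {{ℕ.>-nonZero 1≤S}}) ⟩
          n₀ ℕ.* W₀ ℕ.* S ℕ.+ (1 ℕ.+ 4 ℕ.* (c₂ ℕ.* c₁)) ℕ.* S ℕ.* integralConstant β M
            ≡⟨ id (n₀ ℕ.* W₀) (1 ℕ.+ 4 ℕ.* (c₂ ℕ.* c₁)) S (integralConstant β M) ⟩
          Q ℕ.* S ∎
        where
        id : ∀ x y S z → x ℕ.* S ℕ.+ y ℕ.* S ℕ.* z ≡ (x ℕ.+ y ℕ.* z) ℕ.* S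
        id = ℕS.solve-∀

    tends-to-zero : AvgIntOrbitTendsToZero β
    -- This N₀ forces the root S of N to be at least 2^J, as the dyadic family demands.
    tends-to-zero ε 0<ε = c₁ ℕ.* (2 ℕ.^ J) ℕ.^ d , λ N N₀≤N →
        let S , lo , hi = root c₁ d′ 1≤c₁ N
            2^J≤S = ℕ.s≤s⁻¹ (ℕₚ.≰⇒> (λ S<2^J → ℕₚ.<⇒≱ hi (ℕₚ.≤-trans (ℕₚ.*-monoʳ-≤ c₁ (ℕₚ.^-monoˡ-≤ d S<2^J)) N₀≤N)))
            1≤S = ℕₚ.≤-trans (ℕₚ.m^n>0 2 J) 2^J≤S
            cs , pw , sum≤ = orbit-counts (Ts N S 1≤S lo hi) (proj₁ ∘ ∈-Ts⁻ N S 1≤S lo hi)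
        in Ts N S 1≤S lo hi , enumerates N S 1≤S lo hi , cs , pw ,
           <-ε* ε (sum cs) (length (Ts N S 1≤S lo hi)) 0<ε
             (compare (ℕₚ.≤-trans sum≤ (total≤ N S 1≤S lo hi)) 1≤S (many N S 1≤S lo hi J 2^J≤S))
      where
      open ℕₚ.≤-Reasoning
      q = ↧ₙ ε
      -- The total is at most Q·S and ε is at least 1/q, so J must exceed q·Q; the extra 1 gives
      -- strictness because S is positive.
      J = suc (q ℕ.* Q)
      compare : ∀ {m S l} → m ≤ Q ℕ.* S → 1 ≤ S → J ℕ.* S ≤ l → q ℕ.* m < l
      compare {m} {S} {l} m≤ 1≤S JS≤l = begin-strict
        q ℕ.* m ≤⟨ ℕₚ.*-monoʳ-≤ q m≤ ⟩
        q ℕ.* (Q ℕ.* S) ≡⟨ sym (ℕₚ.*-assoc q Q S) ⟩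
        q ℕ.* Q ℕ.* S <⟨ ℕₚ.m<n+m (q ℕ.* Q ℕ.* S) 1≤S ⟩
        J ℕ.* S ≤⟨ JS≤l ⟩
        l ∎

theorem2p6 : (β : RatFun) → DegRatFunGe3 β → AvgIntOrbitTendsToZero β
theorem2p6 β deg = Average.tends-to-zero β (Heights.model β deg)
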